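{- Let $\beta_n$ denote the number of pairwise non-isomorphic $\tau$-retentive tournaments with $n$ vertices. Then $\beta_6=2$, $\beta_7=26$, $\beta_8\leq 395$, $\beta_9\leq 30596$ and $\beta_{10}\leq 3881175$.
   Context: A tournament $T$ consists of a finite vertex set $V(T)$ and an asymmetric, complete binary relation $\succ$ on $V(T)$ ($x$ dominates $y$ if $x\succ y$). For $v\in V(T)$ let $N^-_T(v)=\{u\in V(T): u\succ v\}$; for $B\subseteq V(T)$, $T[B]$ is the induced subtournament. The tournament equilibrium set $\tau$ is defined recursively: a nonempty $A\subseteq V(T)$ is $\tau$-retentive if for every $v\in A$ with $N^-_T(v)\neq\emptyset$, $\tau(T[N^-_T(v)])\subseteq A$; $A$ is a minimal $\tau$-retentive set if no $\tau$-retentive set of $T$ is a proper subset of $A$; $\tau(T)$ is the union of all minimal $\tau$-retentive sets of $T$. A tournament $H$ is a $\tau$-retentive tournament if there is a tournament $T$ with a minimal $\tau$-retentive set $R$ such that $T[R]$ is isomorphic to $H$. -}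

module Defs where

open import Data.Bool using (Bool; not; false)
open import Data.Nat using (ℕ)
open import Data.Fin using (Fin)
open import Data.Fin.Subset using (Subset; _∈_; _⊆_; _∩_; ⊤; Nonempty)
open import Data.Vec using (tabulate)
open import Data.Product using (Σ; ∃; _×_)
open import Relation.Binary.PropositionalEquality using (_≡_; _≢_)
open import Relation.Nullary using (¬_)
open import Function.Bundles using (_↔_; Inverse)

record Tournament (n : ℕ) : Set where
  field
    beats  : Fin n → Fin n → Bool
    irrefl : ∀ x → beats x x ≡ false
    tourn  : ∀ x y → x ≢ y → beats x y ≡ not (beats y x)
open Tournament public

module _ {n : ℕ} (T : Tournament n) where

  inNbr : Fin n → Subset n
  inNbr v = tabulate (λ u → beats T u v)

  -- Subtournaments T[B] are represented by vertex subsets B of T.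
  -- In T[B], the in-neighbourhood of v is B ∩ N⁻_T(v).
  --
  -- Given an assignment f with f v = τ(T[B ∩ N⁻(v)]) for v ∈ B,
  -- A is f-retentive in T[B] if A ⊆ B is nonempty and for every v ∈ A with
  -- nonempty in-neighbourhood (within T[B]), f v ⊆ A.
  RetentiveWrt : Subset n → (Fin n → Subset n) → Subset n → Set
  RetentiveWrt B f A =
    A ⊆ B × Nonempty A × (∀ v → v ∈ A → Nonempty (B ∩ inNbr v) → f v ⊆ A)

  MinRetentiveWrt : Subset n → (Fin n → Subset n) → Subset n → Set
  MinRetentiveWrt B f A =
    RetentiveWrt B f A × (∀ A' → RetentiveWrt B f A' → A' ⊆ A → A' ≡ A)

  -- TEQ B S : "τ(T[B]) = S", defined by recursion (well-founded on |B|,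
  -- since B ∩ N⁻(v) ⊊ B for v ∈ B):  S is the union of all minimal
  -- τ-retentive sets of T[B].
  data TEQ : Subset n → Subset n → Set where
    teq : ∀ {B S} (f : Fin n → Subset n) →
          (∀ v → v ∈ B → TEQ (B ∩ inNbr v) (f v)) →
          (∀ x → x ∈ S → Σ (Subset n) λ A → MinRetentiveWrt B f A × x ∈ A) →
          (∀ x A → MinRetentiveWrt B f A → x ∈ A → x ∈ S) →
          TEQ B S

  MinTauRetentive : Subset n → Set
  MinTauRetentive R =
    Σ (Fin n → Subset n) λ f →
      (∀ v → v ∈ ⊤ → TEQ (⊤ ∩ inNbr v) (f v)) × MinRetentiveWrt ⊤ f R

InducedIso : ∀ {k m} → Tournament k → Tournament m → Subset m → Set
InducedIso {k} {m} H T R =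
  Σ (Fin k → Fin m) λ φ →
    (∀ i j → φ i ≡ φ j → i ≡ j) ×
    (∀ i → φ i ∈ R) ×
    (∀ x → x ∈ R → ∃ λ i → φ i ≡ x) ×
    (∀ i j → beats H i j ≡ beats T (φ i) (φ j))

TauRetentiveTournament : ∀ {k} → Tournament k → Set
TauRetentiveTournament {k} H =
  Σ ℕ λ m → Σ (Tournament m) λ T → Σ (Subset m) λ R →
    MinTauRetentive T R × InducedIso H T R

_≅_ : ∀ {n} → Tournament n → Tournament n → Set
_≅_ {n} H H' =
  Σ (Fin n ↔ Fin n) λ φ →
    ∀ i j → beats H i j ≡ beats H' (Inverse.to φ i) (Inverse.to φ j)

βEq : ℕ → ℕ → Set
βEq n k =
  Σ (Fin k → Tournament n) λ reps →
    (∀ i → TauRetentiveTournament (reps i)) ×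
    (∀ i j → i ≢ j → ¬ (reps i ≅ reps j)) ×
    (∀ (H : Tournament n) → TauRetentiveTournament H → ∃ λ i → H ≅ reps i)

βLe : ℕ → ℕ → Set
βLe n k =
  Σ (Fin k → Tournament n) λ reps →
    ∀ (H : Tournament n) → TauRetentiveTournament H → ∃ λ i → H ≅ reps i

{-# OPTIONS --safe #-}

-- A vertex u is covered by y if y beats every vertex that u beats. Within a minimal retentive set no
-- vertex is covered, since a covered vertex could be dropped from every retentive set it occurs in.
-- Up to isomorphism such a tournament is given by a vertex u of minimal outdegree k, the tournaments K and M
-- induced on its out- and in-neighbours, and the arcs between them, with every pair in M constrained by the absence
-- of covering. Listing these possibilities bounds the number of tournaments on 8, 9 and 10 vertices. On 6 and 7
-- vertices, a minimal retentive set R of T determines τ(T[N⁻(v)]) for v in R already inside T[R]: it is the least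
-- retentive set there, whenever a least one exists. Hence T[R] is retentive precisely when τ(T[R]) = R.
module Submission where

open import Defs
open import Data.Product using (_×_)
open import Algebra.Properties.CommutativeSemigroup using (x∙yz≈y∙xz)
open import Data.Bool using (Bool; true; false; not; _∧_; if_then_else_; T)
open import Data.Bool.ListAction using (all; and)
open import Data.Bool.Properties using (not-involutive)
open import Data.Empty using (⊥; ⊥-elim)
open import Data.Fin using (Fin; zero; suc; toℕ; fromℕ<)
open import Data.Fin.Properties using (all?; any?; toℕ<n; toℕ-injective; toℕ-fromℕ<) renaming (_≟_ to _≟ᶠ_)
open import Data.Fin.Subset using (Subset; _⊆_; _∩_; _∪_; _-_; ⊤; ⁅_⁆; Nonempty; ∣_∣) renaming (_∈_ to _∈ˢ_; _∉_ to _∉ˢ_; ⊥ to ∅)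
open import Data.Fin.Subset.Properties
  using (_⊆?_; nonempty?; anySubset?; ⊆-refl; ⊆-antisym; ∈⊤; ∉⊥; x∈p∩q⁺; x∈p∩q⁻; p∩q⊆p; x∈p∪q⁻; x∈⁅y⁆⇒x≡y;
         x∈p∧x≢y⇒x∈p-y; x∈p⇒p-x⊂p; p─q⊆p; p⊂q⇒∣p∣<∣q∣)
  renaming (_∈?_ to _∈ˢ?_)
open import Data.List using (List; []; _∷_; _++_; map; concatMap; filterᵇ; zipWith; replicate; applyUpTo; upTo; allFin; length; foldr)
open import Data.List.Membership.Propositional using (_∈_; find; lose)
open import Data.List.Membership.Propositional.Properties
  using (∈-map⁺; ∈-map⁻; ∈-concatMap⁺; ∈-++⁺ˡ; ∈-++⁺ʳ; ∈-++⁻; ∈-∃++; ∈-allFin; ∈-upTo⁺; ∈-upTo⁻; ∈-applyUpTo⁺)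
open import Data.List.Properties
  using (map-cong-local; map-∘; map-++; map-upTo; length-map; length-++; length-upTo; length-tabulate)
open import Data.List.Relation.Binary.Permutation.Propositional using (_↭_; prep; swap; ↭-refl; ↭-sym; ↭-trans; ↭-reflexive; ↭⇒↭ₛ)
open import Data.List.Relation.Binary.Permutation.Propositional.Properties
  using (map⁺; ++⁺; shift; ↭-length; ∈-resp-↭; All-resp-↭)
import Data.List.Relation.Binary.Permutation.Setoid.Properties as Permutationₛ
open import Data.List.Relation.Binary.Pointwise using (Pointwise; []; _∷_)
open import Data.List.Relation.Unary.All as All using (All; []; _∷_)
open import Data.List.Relation.Unary.AllPairs as AllPairs using (AllPairs; []; _∷_)
open import Data.List.Relation.Unary.Any using (Any; here; there)
open import Data.List.Relation.Unary.Unique.Propositional using (Unique)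
open import Data.List.Relation.Unary.Unique.Propositional.Properties as Unique using (allFin⁺)
open import Data.Maybe using (Maybe; just; nothing; is-just; is-nothing)
open import Data.Nat using (ℕ; zero; suc; pred; _+_; _*_; _∸_; _≤_; _<_; _≤ᵇ_; _<ᵇ_; _≡ᵇ_; s≤s; z<s; s<s)
open import Data.Nat.Induction using (<-wellFounded)
open import Data.Nat.ListAction using (sum)
open import Data.Nat.Properties
open import Data.Product using (Σ; ∃; _,_; proj₁; proj₂)
open import Data.Sum using (_⊎_; inj₁; inj₂)
open import Data.Unit using (tt)
open import Data.Vec using (tabulate; lookup)
open import Data.Vec.Properties using (lookup∘tabulate; []=⇒lookup; lookup⇒[]=)
open import Function using (_∘_; id)
open import Function.Bundles using (Inverse; mk↔ₛ′)
open import Induction.WellFounded using (Acc; acc)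
open import Relation.Binary using (tri<; tri≈; tri>)
open import Relation.Binary.PropositionalEquality
  using (_≡_; _≢_; refl; sym; trans; cong; cong₂; subst; subst₂; setoid; module ≡-Reasoning)
open import Relation.Nullary using (¬_; Dec; yes; no; does; ¬?; contradiction)
open import Relation.Nullary.Decidable using (_×-dec_; _→-dec_; decidable-stable; dec-true)

-- Every finite claim is settled by evaluating a list in a proof by `refl`, and the cost of this
-- shapes the lists. Up to 8 vertices isomorphic repetitions are removed; on 9 only the full
-- covering test and the choice of root thin out the list; on 10 it is never formed, its length
-- being found by a parallel recursion. An upper bound tolerates both repetitions and tournaments
-- that are not retentive.
--
-- For the exact values the obstacle is that T is arbitrary outside R, so that in-neighbourhoods in
-- T may leave R and have retentive sets of their own there. Retentiveness of R puts each relevant τ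
-- inside R, hence also every minimal retentive set of which it is the union, and such sets can be
-- compared with sets in H through their traces on R. That a least retentive set exists is not
-- proved in general but tested at each candidate; a failed test would spoil the evaluation, never
-- the conclusion.

private variable
  n : ℕ
  V : Set
  b : V → V → Bool

-- Covered vertices

p-x⊆p : ∀ (p : Subset n) x → p - x ⊆ p
p-x⊆p p x = p─q⊆p p ⁅ x ⁆

x∉p-x : ∀ (p : Subset n) x → x ∉ˢ p - x
x∉p-x p x x∈p-x with x∈p⇒p-x⊂p (p-x⊆p p x x∈p-x)
... | _ , w , w∈p , w∉p-x = w∉p-x (x∈p∧x≢y⇒x∈p-y w∈p λ { refl → w∉p-x x∈p-x })

∈-inNbr⁺ : (T : Tournament n) {u v : Fin n} → beats T u v ≡ true → u ∈ˢ inNbr T v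
∈-inNbr⁺ T {u} {v} p = lookup⇒[]= u (inNbr T v) (trans (lookup∘tabulate _ u) p)

∈-inNbr⁻ : (T : Tournament n) {u v : Fin n} → u ∈ˢ inNbr T v → beats T u v ≡ true
∈-inNbr⁻ T {u} p = trans (sym (lookup∘tabulate _ u)) ([]=⇒lookup p)

beats-total : (T : Tournament n) {u v : Fin n} → u ≢ v → beats T u v ≢ true → beats T v u ≡ true
beats-total T {u} {v} u≢v p with beats T v u | tourn T u v u≢v
... | true  | _ = refl
... | false | q = contradiction q p

module _ (T : Tournament n) where

  teq⇒⊆ : ∀ {B S} → TEQ T B S → S ⊆ B
  teq⇒⊆ (teq f rec inc exc) {x} x∈S with inc x x∈S
  ... | A , ((A⊆B , _) , _) , x∈A = A⊆B x∈A

  retentiveWrt? : ∀ B (f : Fin n → Subset n) A → Dec (RetentiveWrt T B f A)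
  retentiveWrt? B f A = A ⊆? B ×-dec nonempty? A ×-dec
    all? λ v → v ∈ˢ? A →-dec (nonempty? (B ∩ inNbr T v) →-dec f v ⊆? A)

  minimal-below : ∀ B (f : Fin n → Subset n) A → RetentiveWrt T B f A → ∃ (MinRetentiveWrt T B f)
  minimal-below B f A = go A (<-wellFounded ∣ A ∣)
    where
    go : ∀ A → Acc _<_ ∣ A ∣ → RetentiveWrt T B f A → ∃ (MinRetentiveWrt T B f)
    go A (acc smaller) ret
      with anySubset? (λ A' → retentiveWrt? B f A' ×-dec (A' ⊆? A ×-dec ¬? (A ⊆? A')))
    ... | yes (A' , ret' , A'⊆A , A⊈A') = go A' (smaller (p⊂q⇒∣p∣<∣q∣ (A'⊆A , strict))) ret'
      where
      strict : ∃ λ x → x ∈ˢ A × x ∉ˢ A'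
      strict with any? (λ x → x ∈ˢ? A ×-dec ¬? (x ∈ˢ? A'))
      ... | yes found = found
      ... | no none = ⊥-elim (A⊈A' λ {x} x∈A →
              decidable-stable (x ∈ˢ? A') λ x∉A' → none (x , x∈A , x∉A'))
    ... | no none = A , ret , λ A' ret' A'⊆A → ⊆-antisym A'⊆A λ {x} x∈A →
            decidable-stable (x ∈ˢ? A') λ x∉A' → none (A' , ret' , A'⊆A , λ A⊆A' → x∉A' (A⊆A' x∈A))

  -- `B` itself is retentive, since each `f v` lies in an in-neighbourhood inside `B`; a minimal
  -- retentive set below it contributes a vertex to the union.
  teq-nonempty : ∀ {B S} → TEQ T B S → Nonempty B → Nonempty S
  teq-nonempty {B} (teq f rec inc exc) ne
    with minimal-below B f B
           (⊆-refl , ne , λ v v∈B _ {x} x∈fv → p∩q⊆p B (inNbr T v) (teq⇒⊆ (rec v v∈B) x∈fv))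
  ... | A , min@((_ , (x , x∈A) , _) , _) = x , exc x A min x∈A

  -- Domination is asked only on `R`: outside `R` the tournament is arbitrary, and the sets from
  -- which `u` will be deleted all lie in `R`.
  Covers : Subset n → Fin n → Fin n → Set
  Covers R y u = y ≢ u × (∀ x → x ∈ˢ R → beats T u x ≡ true → beats T y x ≡ true)

  -- If u were in a minimal retentive A, deleting it from A would leave a retentive set:
  -- whenever u is present in an in-neighbourhood so is y, and u is not chosen there.
  covered∉τ : ∀ {B S R y u} → TEQ T B S → S ⊆ R → y ∈ˢ B → y ∈ˢ R → u ∈ˢ R → Covers R y u → u ∉ˢ S
  covered∉τ {B} {S} {R} {y} {u} (teq f rec inc exc) S⊆R y∈B y∈R u∈R cov@(y≢u , dom) u∈S
    with inc u u∈S
  ... | A , min@((A⊆B , _ , closed) , least) , u∈A =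
    x∉p-x A u (subst (u ∈ˢ_) (sym (least (A - u) (sub , nonempty , closed′) (p-x⊆p A u))) u∈A)
    where
    A⊆R : A ⊆ R
    A⊆R x∈A = S⊆R (exc _ A min x∈A)
    sub : A - u ⊆ B
    sub x∈ = A⊆B (p-x⊆p A u x∈)
    -- If `u` beat `y`, covering would make `y` beat itself.
    y≻u : beats T y u ≡ true
    y≻u = beats-total T (λ u≡y → y≢u (sym u≡y)) λ u≻y →
      contradiction (trans (sym (irrefl T y)) (dom y y∈R u≻y)) λ ()
    Nu : Nonempty (B ∩ inNbr T u)
    Nu = y , x∈p∩q⁺ (y∈B , ∈-inNbr⁺ T y≻u)
    -- A vertex chosen among the in-neighbours of `u` lies in `A` and survives the deletion, as `u`
    -- does not beat itself.
    nonempty : Nonempty (A - u)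
    nonempty with teq-nonempty (rec u (A⊆B u∈A)) Nu
    ... | w , w∈fu = w , x∈p∧x≢y⇒x∈p-y (closed u u∈A Nu w∈fu) λ { refl →
          contradiction
            (trans (sym (irrefl T u)) (∈-inNbr⁻ T (proj₂ (x∈p∩q⁻ B _ (teq⇒⊆ (rec u (A⊆B u∈A)) w∈fu))))) λ () }
    closed′ : ∀ v → v ∈ˢ A - u → Nonempty (B ∩ inNbr T v) → f v ⊆ A - u
    closed′ v v∈ Nv {w} w∈fv = x∈p∧x≢y⇒x∈p-y (closed v v∈A Nv w∈fv) λ { refl →
      covered∉τ (rec v v∈B) (λ x∈fv → A⊆R (closed v v∈A Nv x∈fv))
        (x∈p∩q⁺ (y∈B , ∈-inNbr⁺ T (dom v (A⊆R v∈A) (u≻v w∈fv)))) y∈R u∈R cov w∈fv }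
      where
      v∈A : v ∈ˢ A
      v∈A = p-x⊆p A u v∈
      v∈B : v ∈ˢ B
      v∈B = A⊆B v∈A
      u≻v : u ∈ˢ f v → beats T u v ≡ true
      u≻v u∈fv = ∈-inNbr⁻ T (proj₂ (x∈p∩q⁻ B _ (teq⇒⊆ (rec v v∈B) u∈fv)))

  -- The deletion argument once more, now against the minimality of `R` in all of `T`; here `y`
  -- itself keeps `R - u` nonempty.
  uncovered : ∀ {R} → MinTauRetentive T R → ∀ {y u} → y ∈ˢ R → u ∈ˢ R → ¬ Covers R y u
  uncovered {R} (f , isτ , (R⊆⊤ , _ , closed) , least) {y} {u} y∈R u∈R cov@(y≢u , dom) =
    x∉p-x R u (subst (u ∈ˢ_) (sym (least (R - u) retentive (p-x⊆p R u))) u∈R)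
    where
    retentive : RetentiveWrt T ⊤ f (R - u)
    retentive = (λ _ → ∈⊤) , (y , x∈p∧x≢y⇒x∈p-y y∈R y≢u) , λ v v∈ Nv {w} w∈fv →
      let v∈R = p-x⊆p R u v∈ in
      x∈p∧x≢y⇒x∈p-y (closed v v∈R Nv w∈fv) λ { refl →
        covered∉τ (isτ v ∈⊤) (closed v v∈R Nv)
          (x∈p∩q⁺ (∈⊤ , ∈-inNbr⁺ T (dom v v∈R
             (∈-inNbr⁻ T (proj₂ (x∈p∩q⁻ ⊤ _ (teq⇒⊆ (isτ v ∈⊤) w∈fv))))))) y∈R u∈R cov w∈fv }

retentive⇒uncovered : {H : Tournament n} → TauRetentiveTournament H →
  ∀ y u → y ≢ u → ¬ (∀ x → beats H u x ≡ true → beats H y x ≡ true)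
retentive⇒uncovered {H = H} (m , T , R , minR , φ , inj , φ∈R , onto , hom) y u y≢u dom =
  uncovered T minR (φ∈R y) (φ∈R u) ((λ eq → y≢u (inj y u eq)) , dom′)
  where
  dom′ : ∀ x → x ∈ˢ R → beats T (φ u) x ≡ true → beats T (φ y) x ≡ true
  dom′ x x∈R φu≻x with onto x x∈R
  ... | i , refl = trans (sym (hom y i)) (dom i (trans (hom u i) φu≻x))

-- Computing τ inside a retentive set

select : {P : Fin n → Set} → (∀ i → Dec (P i)) → Subset n
select P? = tabulate (λ i → does (P? i))

∈-select⁺ : {P : Fin n → Set} (P? : ∀ i → Dec (P i)) {i : Fin n} → P i → i ∈ˢ select P?
∈-select⁺ P? {i} p = lookup⇒[]= i _ (trans (lookup∘tabulate _ i) (dec-true (P? i) p))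

∈-select⁻ : {P : Fin n → Set} (P? : ∀ i → Dec (P i)) {i : Fin n} → i ∈ˢ select P? → P i
∈-select⁻ P? {i} i∈ with P? i | trans (sym (lookup∘tabulate (λ i → does (P? i)) i)) ([]=⇒lookup i∈)
... | yes p | _ = p

module _ (H : Tournament n) where

  Closed : (Fin n → Subset n) → Subset n → Set
  Closed f A = ∀ v → v ∈ˢ A → f v ⊆ A

  -- The case of the recursion defining τ in which the retentive sets have a least element.
  data LeastTau : Subset n → Subset n → Set where
    mkLeast : ∀ {B S} (f : Fin n → Subset n) →
            (∀ v → v ∈ˢ B → LeastTau (B ∩ inNbr H v) (f v)) →
            S ⊆ B → (Nonempty B → Nonempty S) → Closed f S →
            (∀ A → A ⊆ B → Nonempty A → Closed f A → S ⊆ A) →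
            LeastTau B S

  least⇒⊆ : ∀ {B S} → LeastTau B S → S ⊆ B
  least⇒⊆ (mkLeast _ _ S⊆B _ _ _) = S⊆B

  -- Any vertex of `f v` lies in `B ∩ inNbr H v`, so the nonemptiness demanded by `RetentiveWrt`
  -- holds wherever there is something to show.
  retentive⇒closed : ∀ {B f A} → (∀ v → v ∈ˢ B → LeastTau (B ∩ inNbr H v) (f v)) →
                     RetentiveWrt H B f A → Closed f A
  retentive⇒closed {B} rec (A⊆B , _ , closed) v v∈A {x} x∈fv =
    closed v v∈A (x , least⇒⊆ (rec v (A⊆B v∈A)) x∈fv) x∈fv

  least-minimal : ∀ {B S f} → (∀ v → v ∈ˢ B → LeastTau (B ∩ inNbr H v) (f v)) →
                  S ⊆ B → Nonempty S → Closed f S →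
                  (∀ A → A ⊆ B → Nonempty A → Closed f A → S ⊆ A) → MinRetentiveWrt H B f S
  least-minimal rec S⊆B ne closed below =
    (S⊆B , ne , λ v v∈S _ → closed v v∈S) ,
    λ A ret A⊆S → ⊆-antisym A⊆S (below A (proj₁ ret) (proj₁ (proj₂ ret)) (retentive⇒closed rec ret))

  -- A least retentive set is the only minimal one, so the union defining τ reduces to it.
  least⇒teq : ∀ {B S} → LeastTau B S → TEQ H B S
  least⇒teq {B} {S} (mkLeast f rec S⊆B ne closed below) =
    teq f (λ v v∈B → least⇒teq (rec v v∈B))
      (λ x x∈S → S , least-minimal rec S⊆B (x , x∈S) closed below , x∈S)
      λ { x A ((A⊆B , neA , closedA) , minA) x∈A →
          let neS = ne (x , A⊆B x∈A)
              S⊆A = below A A⊆B neA (retentive⇒closed rec (A⊆B , neA , closedA))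
          in subst (x ∈ˢ_) (sym (minA S (S⊆B , neS , λ v v∈S _ → closed v v∈S) S⊆A)) x∈A }

  least⇒retentive : (v : Fin n) → LeastTau ⊤ ⊤ → TauRetentiveTournament H
  least⇒retentive v (mkLeast f rec S⊆B ne closed below) =
    n , H , ⊤ ,
    (f , (λ u u∈ → least⇒teq (rec u u∈)) , least-minimal rec S⊆B (v , ∈⊤) closed below) ,
    (λ i → i) , (λ i j eq → eq) , (λ i → ∈⊤) , (λ x _ → x , refl) , λ i j → refl

  module _ {m} {T : Tournament m} {R : Subset m} (emb : InducedIso H T R) where

    private
      φ : Fin n → Fin m
      φ = proj₁ emb
      φ-inj : ∀ i j → φ i ≡ φ j → i ≡ j
      φ-inj = proj₁ (proj₂ emb)
      onto : ∀ x → x ∈ˢ R → ∃ λ i → φ i ≡ x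
      onto = proj₁ (proj₂ (proj₂ (proj₂ emb)))
      hom : ∀ i j → beats H i j ≡ beats T (φ i) (φ j)
      hom = proj₂ (proj₂ (proj₂ (proj₂ emb)))

    -- `S′` is the preimage of `S` under `φ`, that is, the trace of `S` on `R`. Vertices of `S`
    -- outside `R` are left unrestricted, which in-neighbourhoods in `T` require.
    _≈_ : Subset n → Subset m → Set
    S′ ≈ S = ∀ i → (i ∈ˢ S′ → φ i ∈ˢ S) × (φ i ∈ˢ S → i ∈ˢ S′)

    ≈-inNbr : ∀ {B′ B} v → B′ ≈ B → (B′ ∩ inNbr H v) ≈ (B ∩ inNbr T (φ v))
    ≈-inNbr {B′} {B} v B≈ i =
      (λ i∈ → let (i∈B , i∈N) = x∈p∩q⁻ B′ _ i∈ in
        x∈p∩q⁺ (proj₁ (B≈ i) i∈B , ∈-inNbr⁺ T (trans (sym (hom i v)) (∈-inNbr⁻ H i∈N)))) ,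
      (λ i∈ → let (i∈B , i∈N) = x∈p∩q⁻ B _ i∈ in
        x∈p∩q⁺ (proj₂ (B≈ i) i∈B , ∈-inNbr⁺ H (trans (hom i v) (∈-inNbr⁻ T i∈N))))

    -- The preimage `A′` of `A` is closed and therefore contains `S′`. The image `D` of `S′` is then
    -- a retentive subset of `A`, and minimality gives `D ≡ A`. Both steps use the induction
    -- hypothesis only at vertices of `A`, where `g (φ v) ⊆ A ⊆ R`.
    minimal≈least : ∀ {B′ S′ B A f g} →
      (∀ v → v ∈ˢ B′ → LeastTau (B′ ∩ inNbr H v) (f v)) →
      S′ ⊆ B′ → (Nonempty B′ → Nonempty S′) → Closed f S′ →
      (∀ A → A ⊆ B′ → Nonempty A → Closed f A → S′ ⊆ A) →
      B′ ≈ B → MinRetentiveWrt T B g A → A ⊆ R →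
      (∀ v → v ∈ˢ B′ → Nonempty (B ∩ inNbr T (φ v)) → g (φ v) ⊆ R → f v ≈ g (φ v)) →
      S′ ≈ A
    minimal≈least {B′} {S′} {B} {A} {f} {g} rec S⊆B ne closed below B≈ ((A⊆B , (a , a∈A) , closedA) , minA) A⊆R IH i =
      (λ i∈S → A′⇒A (S⊆A′ i∈S)) ,
      (λ φi∈A → D⇒S (subst (φ i ∈ˢ_) (sym D≡A) φi∈A))
      where
      A′ : Subset n
      A′ = select λ j → φ j ∈ˢ? A
      A′⇒A : ∀ {j} → j ∈ˢ A′ → φ j ∈ˢ A
      A′⇒A = ∈-select⁻ λ j → φ j ∈ˢ? A
      A⇒A′ : ∀ {j} → φ j ∈ˢ A → j ∈ˢ A′
      A⇒A′ = ∈-select⁺ λ j → φ j ∈ˢ? A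
      A′⊆B : A′ ⊆ B′
      A′⊆B {j} j∈ = proj₂ (B≈ j) (A⊆B (A′⇒A j∈))
      neA′ : Nonempty A′
      neA′ with onto a (A⊆R a∈A)
      ... | j , refl = j , A⇒A′ a∈A
      closedA′ : Closed f A′
      closedA′ v v∈A′ {j} j∈fv = A⇒A′ (gv⊆A (proj₁ (IH v (A′⊆B v∈A′) Nv (λ x∈ → A⊆R (gv⊆A x∈)) j) j∈fv))
        where
        Nv : Nonempty (B ∩ inNbr T (φ v))
        Nv = φ j , proj₁ (≈-inNbr v B≈ j) (least⇒⊆ (rec v (A′⊆B v∈A′)) j∈fv)
        gv⊆A : g (φ v) ⊆ A
        gv⊆A = closedA (φ v) (A′⇒A v∈A′) Nv
      S⊆A′ : S′ ⊆ A′
      S⊆A′ = below A′ A′⊆B neA′ closedA′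
      InD? : ∀ x → Dec (∃ λ j → j ∈ˢ S′ × φ j ≡ x)
      InD? x = any? λ j → j ∈ˢ? S′ ×-dec φ j ≟ᶠ x
      D : Subset m
      D = select InD?
      D⇒S : φ i ∈ˢ D → i ∈ˢ S′
      D⇒S φi∈D with ∈-select⁻ InD? φi∈D
      ... | j , j∈S , eq = subst (_∈ˢ S′) (φ-inj j i eq) j∈S
      D⊆A : D ⊆ A
      D⊆A x∈D with ∈-select⁻ InD? x∈D
      ... | j , j∈S , refl = A′⇒A (S⊆A′ j∈S)
      neD : Nonempty D
      neD with ne (proj₁ neA′ , A′⊆B (proj₂ neA′))
      ... | j , j∈S = φ j , ∈-select⁺ InD? (j , j∈S , refl)
      closedD : ∀ x → x ∈ˢ D → Nonempty (B ∩ inNbr T x) → g x ⊆ D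
      closedD x x∈D Nx {w} w∈gx with ∈-select⁻ InD? x∈D
      ... | j , j∈S , refl with onto w (A⊆R (closedA x (D⊆A x∈D) Nx w∈gx))
      ... | k , refl = ∈-select⁺ InD? (k , closed j j∈S (proj₂ (IH j (S⊆B j∈S) Nx gj⊆R k) w∈gx) , refl)
        where
        gj⊆R : g (φ j) ⊆ R
        gj⊆R y∈ = A⊆R (closedA x (D⊆A x∈D) Nx y∈)
      D≡A : D ≡ A
      D≡A = minA D ((λ x∈D → A⊆B (D⊆A x∈D)) , neD , closedD) D⊆A

    -- Since `S ⊆ R`, every minimal retentive set of `T[B]` lies in `R` and has trace `S′`, so their
    -- union has it too. Nonemptiness of `B` guarantees that there is at least one.
    least≈τ : ∀ {B′ S′ B S} → LeastTau B′ S′ → TEQ T B S → B′ ≈ B → Nonempty B → S ⊆ R → S′ ≈ S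
    least≈τ (mkLeast f rec S⊆B ne closed below) t@(teq g recT inc exc) B≈ neB S⊆R i =
      (λ i∈S → let (x , x∈S) = teq-nonempty T t neB
                   (A , minA , x∈A) = inc x x∈S
               in exc _ A minA (proj₁ (through A minA i) i∈S)) ,
      (λ φi∈S → let (A , minA , φi∈A) = inc _ φi∈S in proj₂ (through A minA i) φi∈A)
      where
      through = λ A minA → minimal≈least rec S⊆B ne closed below B≈ minA (λ {x} x∈A → S⊆R (exc x A minA x∈A))
        (λ v v∈B Nv gv⊆R → least≈τ (rec v v∈B) (recT (φ v) (proj₁ (B≈ v) v∈B)) (≈-inNbr v B≈) Nv gv⊆R)

  -- `R` itself is minimal retentive in `T`, and its trace is the whole of `H`.
  retentive⇒full : ∀ {S} → TauRetentiveTournament H → LeastTau ⊤ S → ∀ i → i ∈ˢ S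
  retentive⇒full (m , T , R , (g , isτ , minR) , emb) (mkLeast f rec S⊆B ne closed below) i =
    proj₂ (minimal≈least {T = T} emb rec S⊆B ne closed below (λ _ → (λ _ → ∈⊤) , (λ _ → ∈⊤)) minR ⊆-refl
      (λ v v∈B Nv gv⊆R → least≈τ {T = T} emb (rec v v∈B) (isτ _ ∈⊤)
        (≈-inNbr {T = T} emb v (λ _ → (λ _ → ∈⊤) , (λ _ → ∈⊤))) Nv gv⊆R) i)
      (proj₁ (proj₂ (proj₂ emb)) i)

  -- Searching for a least retentive set

  expand : (Fin n → Subset n) → Subset n → List (Fin n) → Subset n
  expand f X = foldr (λ v Y → if lookup X v then f v ∪ Y else Y) X

  -- Only the containment of the result in every closed superset of `X` is proved. Whether the
  -- rounds suffice never has to be known, because `leastFrom` tests closedness of its final set.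
  closure : ℕ → (Fin n → Subset n) → Subset n → Subset n
  closure zero    f X = X
  closure (suc t) f X = closure t f (expand f X (allFin n))

  expand-⊆ : ∀ {f A} X → Closed f A → X ⊆ A → ∀ vs → expand f X vs ⊆ A
  expand-⊆ X closed X⊆A []       = X⊆A
  expand-⊆ {f} X closed X⊆A (v ∷ vs) x∈ with lookup X v in eq
  ... | false = expand-⊆ X closed X⊆A vs x∈
  ... | true with x∈p∪q⁻ (f v) _ x∈
  ...   | inj₁ x∈fv = closed v (X⊆A (lookup⇒[]= v X eq)) x∈fv
  ...   | inj₂ x∈Y  = expand-⊆ X closed X⊆A vs x∈Y

  closure-⊆ : ∀ t {f A} X → Closed f A → X ⊆ A → closure t f X ⊆ A
  closure-⊆ zero    X closed X⊆A = X⊆A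
  closure-⊆ (suc t) X closed X⊆A = closure-⊆ t _ closed (expand-⊆ X closed X⊆A (allFin n))

all-just : {P : Fin n → Set} → (∀ i → Maybe (P i)) → Maybe (∀ i → P i)
all-just {zero}  g = just λ ()
all-just {suc n} g with g zero | all-just (λ i → g (suc i))
... | just p | just q = just λ { zero → p ; (suc i) → q i }
... | _      | _      = nothing

meet : Subset n → (Fin n → Subset n) → List (Fin n) → Subset n
meet B cl = foldr (λ w X → if lookup B w then cl w ∩ X else X) B

meet-⊆ : ∀ (B : Subset n) cl ws → meet B cl ws ⊆ B
meet-⊆ B cl []       x∈ = x∈
meet-⊆ B cl (w ∷ ws) x∈ with lookup B w
... | true  = meet-⊆ B cl ws (proj₂ (x∈p∩q⁻ (cl w) _ x∈))
... | false = meet-⊆ B cl ws x∈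

meet-⊆-each : ∀ (B : Subset n) cl ws {w} → w ∈ˢ B → w ∈ ws → meet B cl ws ⊆ cl w
meet-⊆-each B cl (w ∷ ws) w∈B (here refl) x∈ rewrite []=⇒lookup w∈B = proj₁ (x∈p∩q⁻ (cl w) _ x∈)
meet-⊆-each B cl (v ∷ ws) w∈B (there w∈)  x∈ with lookup B v
... | true  = meet-⊆-each B cl ws w∈B w∈ (proj₂ (x∈p∩q⁻ (cl v) _ x∈))
... | false = meet-⊆-each B cl ws w∈B w∈ x∈

module _ (H : Tournament n) where

  -- If there is a least retentive set, it is the intersection of the closures of all vertices.
  leastFrom : ∀ B → (∀ v → Σ (Subset n) λ F → v ∈ˢ B → LeastTau H (B ∩ inNbr H v) F) → Maybe (∃ (LeastTau H B))
  leastFrom B h = check (meet B cl (allFin n)) (meet-⊆ B cl (allFin n))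
                        λ w∈B → meet-⊆-each B cl (allFin n) w∈B (∈-allFin _)
    where
    f : Fin n → Subset n
    f v = proj₁ (h v)
    cl : Fin n → Subset n
    cl v = closure H n f ⁅ v ⁆
    check : ∀ S → S ⊆ B → (∀ {w} → w ∈ˢ B → S ⊆ cl w) → Maybe (∃ (LeastTau H B))
    check S S⊆B S⊆cl with nonempty? S ×-dec all? (λ x → x ∈ˢ? S →-dec f x ⊆? S)
    ... | no _ = nothing
    ... | yes (ne , closed) = just (S , mkLeast f (λ u → proj₂ (h u)) S⊆B (λ _ → ne) closed
            -- A nonempty closed `A` contains the closure of one of its vertices, hence the
            -- intersection of all the closures.
            λ A A⊆B (a , a∈A) closedA x∈ → closure-⊆ H n ⁅ a ⁆ closedA
              (λ y∈ → subst (_∈ˢ A) (sym (x∈⁅y⁆⇒x≡y a y∈)) a∈A) (S⊆cl (A⊆B a∈A) x∈))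

  leastTau? : ℕ → ∀ B → Maybe (∃ (LeastTau H B))
  leastTau? zero    B = nothing
  leastTau? (suc t) B with nonempty? B
  ... | no empty = just (∅ , mkLeast (λ _ → ∅) (λ v v∈B → ⊥-elim (empty (v , v∈B)))
                       (λ x∈ → ⊥-elim (∉⊥ x∈)) (λ ne → ⊥-elim (empty ne)) (λ v v∈ → ⊥-elim (∉⊥ v∈))
                       (λ A _ _ _ x∈ → ⊥-elim (∉⊥ x∈)))
  ... | yes _ with all-just {P = λ v → Σ (Subset n) λ F → v ∈ˢ B → LeastTau H (B ∩ inNbr H v) F} below
    where
    below : ∀ v → Maybe (Σ (Subset n) λ F → v ∈ˢ B → LeastTau H (B ∩ inNbr H v) F)
    below v with v ∈ˢ? B
    ... | no v∉B = just (∅ , λ v∈B → ⊥-elim (v∉B v∈B))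
    ... | yes _ with leastTau? t (B ∩ inNbr H v)
    ...   | just (F , l) = just (F , λ _ → l)
    ...   | nothing      = nothing
  ...   | nothing = nothing
  ...   | just h  = leastFrom B h

retentive? : (H : Tournament (suc n)) → Maybe (Dec (TauRetentiveTournament H))
-- Nested in-neighbourhoods shrink strictly, so a chain from `suc n` vertices down to the empty set
-- has at most `suc (suc n)` members.
retentive? {n} H with leastTau? H (suc (suc n)) ⊤
... | nothing = nothing
... | just (S , l) with all? (λ i → i ∈ˢ? S)
...   | yes full = just (yes (least⇒retentive H zero (subst (LeastTau H ⊤) (⊆-antisym (λ _ → ∈⊤) (λ {i} _ → full i)) l)))
...   | no ¬full = just (no λ r → ¬full (retentive⇒full H r l))

-- Codes of tournaments

record IsTournament {V : Set} (b : V → V → Bool) : Set where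
  field
    loopless : ∀ x → b x x ≡ false
    flips    : ∀ {x y} → x ≢ y → b x y ≡ not (b y x)

  arc⇒≢ : ∀ {x y} → b x y ≡ true → x ≢ y
  arc⇒≢ p refl = contradiction (trans (sym p) (loopless _)) λ ()

  reverse : ∀ {x y} → b y x ≡ true → b x y ≡ false
  reverse p = trans (flips λ { refl → arc⇒≢ p refl }) (cong not p)
open IsTournament public

-- The strict upper triangle of an adjacency matrix: each row holds the arcs from a vertex to the
-- later ones.
Code : Set
Code = List (List Bool)

code : (V → V → Bool) → List V → Code
code b []       = []
code b (x ∷ xs) = map (b x) xs ∷ code b xs

code-map : ∀ {W : Set} {b : V → V → Bool} {b′ : W → W → Bool} {f : V → W} xs →
           (∀ {x y} → x ∈ xs → y ∈ xs → b′ (f x) (f y) ≡ b x y) → code b′ (map f xs) ≡ code b xs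
code-map []       eq = refl
code-map (x ∷ xs) eq = cong₂ _∷_
  (trans (sym (map-∘ xs)) (map-cong-local (All.tabulate λ y∈ → eq (here refl) (there y∈))))
  (code-map xs λ x∈ y∈ → eq (there x∈) (there y∈))

bit : List Bool → ℕ → Bool
bit []      _       = false
bit (t ∷ r) zero    = t
bit (t ∷ r) (suc j) = bit r j

-- Totalised outside the rows of the code, so that every code gives a tournament on ℕ.
beatsAt : Code → ℕ → ℕ → Bool
beatsAt []      i       j       = i <ᵇ j
beatsAt (r ∷ c) zero    zero    = false
beatsAt (r ∷ c) zero    (suc j) = bit r j
beatsAt (r ∷ c) (suc i) zero    = not (bit r i)
beatsAt (r ∷ c) (suc i) (suc j) = beatsAt c i j

<ᵇ-irrefl : ∀ i → (i <ᵇ i) ≡ false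
<ᵇ-irrefl zero    = refl
<ᵇ-irrefl (suc i) = <ᵇ-irrefl i

<ᵇ-flips : ∀ {i j} → i ≢ j → (i <ᵇ j) ≡ not (j <ᵇ i)
<ᵇ-flips {zero}  {zero}  i≢j = contradiction refl i≢j
<ᵇ-flips {zero}  {suc j} i≢j = refl
<ᵇ-flips {suc i} {zero}  i≢j = refl
<ᵇ-flips {suc i} {suc j} i≢j = <ᵇ-flips (i≢j ∘ cong suc)

beatsAt-isTournament : ∀ c → IsTournament (beatsAt c)
loopless (beatsAt-isTournament [])      i       = <ᵇ-irrefl i
loopless (beatsAt-isTournament (r ∷ c)) zero    = refl
loopless (beatsAt-isTournament (r ∷ c)) (suc i) = loopless (beatsAt-isTournament c) i
flips (beatsAt-isTournament [])      i≢j                     = <ᵇ-flips i≢j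
flips (beatsAt-isTournament (r ∷ c)) {zero}  {zero}  i≢j = contradiction refl i≢j
flips (beatsAt-isTournament (r ∷ c)) {zero}  {suc j} i≢j = sym (not-involutive _)
flips (beatsAt-isTournament (r ∷ c)) {suc i} {zero}  i≢j = refl
flips (beatsAt-isTournament (r ∷ c)) {suc i} {suc j} i≢j = flips (beatsAt-isTournament c) (i≢j ∘ cong suc)

nth : V → List V → ℕ → V
nth d []       _       = d
nth d (x ∷ xs) zero    = x
nth d (x ∷ xs) (suc i) = nth d xs i

nth-∈ : ∀ (d : V) xs {i} → i < length xs → nth d xs i ∈ xs
nth-∈ d (x ∷ xs) {zero}  _       = here refl
nth-∈ d (x ∷ xs) {suc i} (s<s p) = there (nth-∈ d xs p)

map-nth : ∀ (d : V) xs → map (nth d xs) (upTo (length xs)) ≡ xs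
map-nth d xs = trans (map-upTo (nth d xs) (length xs)) (applyUpTo-nth xs)
  where
  applyUpTo-nth : ∀ xs → applyUpTo (nth d xs) (length xs) ≡ xs
  applyUpTo-nth []       = refl
  applyUpTo-nth (x ∷ xs) = cong (x ∷_) (applyUpTo-nth xs)

bit-map : ∀ (f : V → Bool) d xs {i} → i < length xs → bit (map f xs) i ≡ f (nth d xs i)
bit-map f d (x ∷ xs) {zero}  _       = refl
bit-map f d (x ∷ xs) {suc i} (s<s p) = bit-map f d xs p

beatsAt-code : IsTournament b → ∀ d xs → Unique xs → ∀ {i j} → i < length xs → j < length xs →
               beatsAt (code b xs) i j ≡ b (nth d xs i) (nth d xs j)
beatsAt-code isT d (x ∷ xs) u        {zero}  {zero}  _ _ = sym (loopless isT x)
beatsAt-code isT d (x ∷ xs) u        {zero}  {suc j} _ (s<s q) = bit-map _ d xs q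
beatsAt-code isT d (x ∷ xs) (x≢ ∷ u) {suc i} {zero}  (s<s p) _ =
  trans (cong not (bit-map _ d xs p)) (sym (flips isT λ eq → All.lookup x≢ (nth-∈ d xs p) (sym eq)))
beatsAt-code isT d (x ∷ xs) (_ ∷ u)  {suc i} {suc j} (s<s p) (s<s q) = beatsAt-code isT d xs u p q

-- Ranging over all vertex types and all lists of vertices lets the property be applied directly to
-- the neighbourhoods of a root, without renumbering them.
Complete : ℕ → List Code → Set₁
Complete n L = ∀ {V : Set} (b : V → V → Bool) → IsTournament b →
  ∀ xs → Unique xs → length xs ≡ n → ∃ λ ys → ys ↭ xs × code b ys ∈ L

boolLists : ℕ → List (List Bool)
boolLists zero    = [] ∷ []
boolLists (suc n) = map (false ∷_) (boolLists n) ++ map (true ∷_) (boolLists n)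

∈-boolLists : ∀ r → r ∈ boolLists (length r)
∈-boolLists []          = here refl
∈-boolLists (false ∷ r) = ∈-++⁺ˡ (∈-map⁺ (false ∷_) (∈-boolLists r))
∈-boolLists (true ∷ r)  = ∈-++⁺ʳ (map (false ∷_) (boolLists (length r))) (∈-map⁺ (true ∷_) (∈-boolLists r))

extend : ℕ → List Code → List Code
extend n L = concatMap (λ r → map (r ∷_) L) (boolLists n)

extend-complete : ∀ {n L} → Complete n L → Complete (suc n) (extend n L)
extend-complete {n} {L} complete b isT (x ∷ xs) (_ ∷ u) len with complete b isT xs u (suc-injective len)
... | ys , ys↭xs , ys∈L = x ∷ ys , prep x ys↭xs ,
  ∈-concatMap⁺ (λ r → map (r ∷_) L) (lose row∈ (∈-map⁺ (map (b x) ys ∷_) ys∈L))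
  where
  row∈ : map (b x) ys ∈ boolLists n
  row∈ = subst (λ k → map (b x) ys ∈ boolLists k)
    (trans (length-map (b x) ys) (trans (↭-length ys↭xs) (suc-injective len)))
    (∈-boolLists (map (b x) ys))

unique-↭ : ∀ {xs ys : List V} → xs ↭ ys → Unique xs → Unique ys
unique-↭ p = Permutationₛ.Unique-resp-↭ (setoid _) (↭⇒↭ₛ p)

unique-⊆⇒↭ : ∀ {xs ys : List V} → Unique ys → (∀ {y} → y ∈ ys → y ∈ xs) → length ys ≡ length xs → ys ↭ xs
unique-⊆⇒↭ {xs = []}    {[]}     u        sub len = ↭-refl
unique-⊆⇒↭ {xs = xs}    {y ∷ ys} (y≢ ∷ u) sub len with ∈-∃++ (sub (here refl))
... | as , bs , refl = ↭-trans (prep y (unique-⊆⇒↭ u sub′ len′)) (↭-sym (shift y as bs))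
  where
  len′ : length ys ≡ length (as ++ bs)
  len′ = suc-injective (trans len (↭-length (shift y as bs)))
  sub′ : ∀ {z} → z ∈ ys → z ∈ as ++ bs
  sub′ z∈ with ∈-resp-↭ (shift y as bs) (sub (there z∈))
  ... | here refl = contradiction refl (All.lookup y≢ z∈)
  ... | there z∈′ = z∈′

∈-filterᵇ⁻ : ∀ (p : V → Bool) {v} xs → v ∈ filterᵇ p xs → v ∈ xs × p v ≡ true
∈-filterᵇ⁻ p (x ∷ xs) v∈ with p x in eq
∈-filterᵇ⁻ p (x ∷ xs) (here refl) | true  = here refl , eq
∈-filterᵇ⁻ p (x ∷ xs) (there v∈)  | true  = let (a , q) = ∈-filterᵇ⁻ p xs v∈ in there a , q
∈-filterᵇ⁻ p (x ∷ xs) v∈          | false = let (a , q) = ∈-filterᵇ⁻ p xs v∈ in there a , q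

∈-filterᵇ⁺ : ∀ (p : V → Bool) {v xs} → v ∈ xs → p v ≡ true → v ∈ filterᵇ p xs
∈-filterᵇ⁺ p {v} {x ∷ xs} v∈ pv with p x in eq
∈-filterᵇ⁺ p (here refl) pv | true  = here refl
∈-filterᵇ⁺ p (there v∈)  pv | true  = there (∈-filterᵇ⁺ p v∈ pv)
∈-filterᵇ⁺ p (here refl) pv | false = contradiction (trans (sym pv) eq) λ ()
∈-filterᵇ⁺ p (there v∈)  pv | false = ∈-filterᵇ⁺ p v∈ pv

-- Backtracking search for an ordering with a prescribed code

module Search (b : V → V → Bool) where

  narrow : V → List Bool → List (List V) → List (List V)
  narrow x []          []       = []
  narrow x (true ∷ r)  (d ∷ ds) = filterᵇ (b x) d ∷ narrow x r ds
  narrow x (false ∷ r) (d ∷ ds) = filterᵇ (λ y → b y x) d ∷ narrow x r ds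
  -- A length mismatch leaves an empty domain, which no vertex can fill, so the search fails.
  narrow x _           _        = [] ∷ []

  mutual
    embed : Code → List (List V) → Maybe (List V)
    embed []      []       = just []
    embed (r ∷ c) (d ∷ ds) = embedFrom r c d ds
    embed _       _        = nothing

    embedFrom : List Bool → Code → List V → List (List V) → Maybe (List V)
    embedFrom r c []      ds = nothing
    embedFrom r c (x ∷ d) ds with embed c (narrow x r ds)
    ... | just ys = just (x ∷ ys)
    ... | nothing = embedFrom r c d ds

  module _ (isT : IsTournament b) where

    narrow-sound : ∀ {x ys} r ds → Pointwise _∈_ ys (narrow x r ds) →
                   map (b x) ys ≡ r × All (x ≢_) ys × Pointwise _∈_ ys ds
    narrow-sound []          []       []        = refl , [] , []
    narrow-sound (true ∷ r)  (d ∷ ds) (y∈ ∷ ps) with ∈-filterᵇ⁻ _ d y∈ | narrow-sound r ds ps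
    ... | y∈d , x≻y | eq , x≢ , ps′ = cong₂ _∷_ x≻y eq , arc⇒≢ isT x≻y ∷ x≢ , y∈d ∷ ps′
    narrow-sound (false ∷ r) (d ∷ ds) (y∈ ∷ ps) with ∈-filterᵇ⁻ _ d y∈ | narrow-sound r ds ps
    ... | y∈d , y≻x | eq , x≢ , ps′ =
      cong₂ _∷_ (reverse isT y≻x) eq , (λ { refl → arc⇒≢ isT y≻x refl }) ∷ x≢ , y∈d ∷ ps′
    narrow-sound []          (d ∷ ds) (() ∷ _)
    narrow-sound (true ∷ r)  []       (() ∷ _)
    narrow-sound (false ∷ r) []       (() ∷ _)

    mutual
      embed-sound : ∀ c ds {ys} → embed c ds ≡ just ys → code b ys ≡ c × Unique ys × Pointwise _∈_ ys ds
      embed-sound []      []       refl = refl , [] , []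
      embed-sound (r ∷ c) (d ∷ ds) eq   with embedFrom-sound r c d ds eq
      ... | p , u , q = p , u , q

      embedFrom-sound : ∀ r c d ds {ys} → embedFrom r c d ds ≡ just ys →
                        code b ys ≡ r ∷ c × Unique ys × Pointwise _∈_ ys (d ∷ ds)
      embedFrom-sound r c (x ∷ d) ds eq with embed c (narrow x r ds) in eq′
      embedFrom-sound r c (x ∷ d) ds refl | just ys with embed-sound c _ eq′
      ... | refl , u , ps with narrow-sound r ds ps
      ...   | refl , x≢ , ps′ = refl , x≢ ∷ u , here refl ∷ ps′
      embedFrom-sound r c (x ∷ d) ds eq | nothing with embedFrom-sound r c d ds eq
      ... | p , u , (y∈ ∷ q) = p , u , there y∈ ∷ q

    narrow-complete : ∀ {x ys ds} → All (x ≢_) ys → Pointwise _∈_ ys ds → Pointwise _∈_ ys (narrow x (map (b x) ys) ds)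
    narrow-complete []        []        = []
    narrow-complete {x} {y ∷ ys} (x≢y ∷ x≢) (y∈ ∷ ps) with b x y in eq
    ... | true  = ∈-filterᵇ⁺ (b x) y∈ eq ∷ narrow-complete x≢ ps
    ... | false = ∈-filterᵇ⁺ (λ z → b z x) y∈ (trans (flips isT (x≢y ∘ sym)) (cong not eq)) ∷ narrow-complete x≢ ps

    mutual
      -- Makes failure conclusive: `nothing` certifies that no ordering within the domains has the
      -- code, which is how tournaments are shown non-isomorphic.
      embed-complete : ∀ ys {ds} → Unique ys → Pointwise _∈_ ys ds → embed (code b ys) ds ≢ nothing
      embed-complete []       _        []        = λ ()
      embed-complete (y ∷ ys) (y≢ ∷ u) (y∈ ∷ ps) = embedFrom-complete y∈ y≢ u ps

      embedFrom-complete : ∀ {y ys d ds} → y ∈ d → All (y ≢_) ys → Unique ys → Pointwise _∈_ ys ds →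
                           embedFrom (map (b y) ys) (code b ys) d ds ≢ nothing
      embedFrom-complete {y} {ys} {x ∷ d} {ds} y∈ y≢ u ps
        with embed (code b ys) (narrow x (map (b y) ys) ds) in eq
      ... | just _  = λ ()
      embedFrom-complete {ys = ys} (here refl) y≢ u ps | nothing =
        contradiction eq (embed-complete ys u (narrow-complete y≢ ps))
      embedFrom-complete (there y∈) y≢ u ps | nothing = embedFrom-complete y∈ y≢ u ps

-- Rearrangements and removal of repetitions

rearrange : ℕ → Code → Code → Maybe (List ℕ)
rearrange n c d = Search.embed (beatsAt c) d (replicate n (upTo n))

pointwise-replicate : ∀ {A B : Set} {R : A → B → Set} {ys : List A} {y} n → Pointwise R ys (replicate n y) →
                      length ys ≡ n × All (λ x → R x y) ys
pointwise-replicate zero    []       = refl , []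
pointwise-replicate (suc n) (p ∷ ps) with pointwise-replicate n ps
... | len , all = cong suc len , p ∷ all

rearrange-sound : ∀ n c d {is} → rearrange n c d ≡ just is → is ↭ upTo n × code (beatsAt c) is ≡ d
rearrange-sound n c d {is} eq
  with Search.embed-sound (beatsAt c) (beatsAt-isTournament c) d _ eq
... | p , u , ps with pointwise-replicate n ps
... | len , all = unique-⊆⇒↭ u (All.lookup all) (trans len (sym (length-upTo n))) , p

-- A rearrangement found on the positions of a code carries over to every tournament with that code,
-- by reading positions as vertices.
code-rearranged : IsTournament b → ∀ n xs → Unique xs → length xs ≡ n → ∀ {d is} →
                  is ↭ upTo n → code (beatsAt (code b xs)) is ≡ d → ∃ λ ys → ys ↭ xs × code b ys ≡ d
code-rearranged {b = b} isT n []         u refl {is = is} is↭ eq with ↭-length is↭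
code-rearranged {b = b} isT n []         u refl {is = []} is↭ eq | _ = [] , ↭-refl , eq
code-rearranged {b = b} isT n xs@(x ∷ _) u refl {is = is} is↭ eq =
  map (nth x xs) is ,
  ↭-trans (map⁺ (nth x xs) is↭) (↭-reflexive (map-nth x xs)) ,
  trans (code-map is λ i∈ j∈ → sym (beatsAt-code isT x xs u (<n i∈) (<n j∈))) eq
  where
  <n : ∀ {i} → i ∈ is → i < length xs
  <n i∈ = ∈-upTo⁻ (∈-resp-↭ is↭ i∈)

-- h only selects the pairs worth comparing: nothing is assumed about it.
module Dedupe (h : Code → ℕ) (n : ℕ) where

  represented : ℕ → Code → List (ℕ × Code) → Bool
  represented k c []              = false
  represented k c ((k′ , d) ∷ ds) =
    if (k ≡ᵇ k′) ∧ is-just (rearrange n c d) then true else represented k c ds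

  dedupeOnto : List (ℕ × Code) → List Code → List (ℕ × Code)
  dedupeOnto ds []      = ds
  dedupeOnto ds (c ∷ L) = if represented (h c) c ds then dedupeOnto ds L else dedupeOnto ((h c , c) ∷ ds) L

  dedupe : List Code → List Code
  dedupe L = map proj₂ (dedupeOnto [] L)

  Rearranges : Code → Code → Set
  Rearranges c d = c ≡ d ⊎ (∃ λ is → is ↭ upTo n × code (beatsAt c) is ≡ d)

  represented-sound : ∀ k c ds → represented k c ds ≡ true → Any (Rearranges c ∘ proj₂) ds
  represented-sound k c ((k′ , d) ∷ ds) eq with k ≡ᵇ k′
  ... | false = there (represented-sound k c ds eq)
  ... | true with rearrange n c d in eq′
  ...   | nothing = there (represented-sound k c ds eq)
  ...   | just is = here (inj₂ (is , rearrange-sound n c d eq′))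

  keeps : ∀ {c} ds L → Any (Rearranges c ∘ proj₂) ds → Any (Rearranges c ∘ proj₂) (dedupeOnto ds L)
  keeps ds []      p = p
  keeps ds (c ∷ L) p with represented (h c) c ds
  ... | true  = keeps ds L p
  ... | false = keeps _ L (there p)

  dedupeOnto-sound : ∀ {c} ds L → c ∈ L → Any (Rearranges c ∘ proj₂) (dedupeOnto ds L)
  dedupeOnto-sound ds (c ∷ L) c∈ with represented (h c) c ds in eq
  dedupeOnto-sound ds (c ∷ L) (here refl) | true  = keeps ds L (represented-sound (h c) c ds eq)
  dedupeOnto-sound ds (c ∷ L) (here refl) | false = keeps _ L (here (inj₁ refl))
  dedupeOnto-sound ds (c ∷ L) (there c∈)  | true  = dedupeOnto-sound ds L c∈
  dedupeOnto-sound ds (c ∷ L) (there c∈)  | false = dedupeOnto-sound _ L c∈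

  dedupe-sound : IsTournament b → ∀ {L} xs → Unique xs → length xs ≡ n → code b xs ∈ L →
                 ∃ λ ys → ys ↭ xs × code b ys ∈ dedupe L
  dedupe-sound {b = b} isT {L} xs u len c∈ with find (dedupeOnto-sound [] L c∈)
  ... | (_ , d) , d∈ , inj₁ refl = xs , ↭-refl , ∈-map⁺ proj₂ d∈
  ... | (_ , d) , d∈ , inj₂ (is , is↭ , eq) with code-rearranged isT n xs u len is↭ eq
  ...   | ys , ys↭xs , refl = ys , ys↭xs , ∈-map⁺ proj₂ d∈

  dedupe-complete : ∀ {L} → Complete n L → Complete n (dedupe L)
  dedupe-complete complete b isT xs u len with complete b isT xs u len
  ... | ys , ys↭xs , c∈ with dedupe-sound isT ys (unique-↭ (↭-sym ys↭xs) u) (trans (↭-length ys↭xs) len) c∈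
  ...   | zs , zs↭ys , d∈ = zs , ↭-trans zs↭ys ys↭xs , d∈

-- Outdegrees, walks and covering in a code

≡true : ∀ {t} → T t → t ≡ true
≡true {true} _ = refl

size : List Bool → ℕ
size []          = 0
size (true ∷ r)  = suc (size r)
size (false ∷ r) = size r

_⊑_ : List Bool → List Bool → Bool
[]          ⊑ _           = true
(false ∷ r) ⊑ (_ ∷ s)     = r ⊑ s
(true ∷ r)  ⊑ (true ∷ s)  = r ⊑ s
(true ∷ r)  ⊑ (false ∷ s) = false
(_ ∷ r)     ⊑ []          = false

⊑-map : ∀ (f g : V → Bool) xs → map f xs ⊑ map g xs ≡ true → ∀ {z} → z ∈ xs → f z ≡ true → g z ≡ true
⊑-map f g (x ∷ xs) p z∈ fz with f x in fx | g x in gx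
⊑-map f g (x ∷ xs) p (here refl) fz | false | _    = contradiction (trans (sym fz) fx) λ ()
⊑-map f g (x ∷ xs) p (there z∈)  fz | false | _    = ⊑-map f g xs p z∈ fz
⊑-map f g (x ∷ xs) p (here refl) fz | true  | true = gx
⊑-map f g (x ∷ xs) p (there z∈)  fz | true  | true = ⊑-map f g xs p z∈ fz

rows : Code → List (List Bool)
rows []      = []
rows (r ∷ c) = (false ∷ r) ∷ zipWith (λ t R → not t ∷ R) r (rows c)

adjacency : (V → V → Bool) → List V → List V → List (List Bool)
adjacency b xs = map (λ x → map (b x) xs)

rows-code : IsTournament b → ∀ {xs} → Unique xs → rows (code b xs) ≡ adjacency b xs xs
rows-code isT [] = refl
rows-code {b = b} isT {x ∷ xs} (x≢ ∷ u) rewrite rows-code isT u | loopless isT x =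
  cong ((false ∷ map (b x) xs) ∷_) (column xs (All.map (λ x≢y → sym (flips isT (x≢y ∘ sym))) x≢))
  where
  column : ∀ ys → All (λ y → not (b x y) ≡ b y x) ys →
           zipWith (λ t R → not t ∷ R) (map (b x) ys) (adjacency b xs ys) ≡ adjacency b (x ∷ xs) ys
  column []       []       = refl
  column (y ∷ ys) (e ∷ es) = cong₂ _∷_ (cong (_∷ map (b y) xs) e) (column ys es)

Antichain : (V → V → Bool) → List V → Set
Antichain b xs = ∀ {x y} → x ∈ xs → y ∈ xs → x ≢ y → ¬ (∀ {z} → z ∈ xs → b x z ≡ true → b y z ≡ true)

antichain-↭ : ∀ {xs ys} → xs ↭ ys → Antichain b xs → Antichain b ys
antichain-↭ p anti x∈ y∈ x≢y dom =
  anti (∈-resp-↭ (↭-sym p) x∈) (∈-resp-↭ (↭-sym p) y∈) x≢y λ z∈ → dom (∈-resp-↭ p z∈)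

incomparable? : List Bool → List (List Bool) → Bool
incomparable? R []       = true
incomparable? R (S ∷ Rs) = if R ⊑ S then false else (if S ⊑ R then false else incomparable? R Rs)

antichain? : List (List Bool) → Bool
antichain? []       = true
antichain? (R ∷ Rs) = incomparable? R Rs ∧ antichain? Rs

¬true⇒not : ∀ {t} → t ≢ true → not t ≡ true
¬true⇒not {false} _ = refl
¬true⇒not {true}  p = contradiction refl p

∧-true : ∀ {s t} → s ≡ true → t ≡ true → s ∧ t ≡ true
∧-true refl refl = refl

antichain?-true : ∀ {xs} → Antichain b xs → ∀ {ys} → Unique ys → (∀ {y} → y ∈ ys → y ∈ xs) →
                  antichain? (adjacency b xs ys) ≡ true
antichain?-true anti [] sub = refl
antichain?-true {b = b} {xs = xs} anti {y ∷ ys} (y≢ ∷ u) sub =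
  ∧-true (others ys y≢ (sub ∘ there)) (antichain?-true anti u (sub ∘ there))
  where
  others : ∀ zs → All (y ≢_) zs → (∀ {z} → z ∈ zs → z ∈ xs) →
           incomparable? (map (b y) xs) (adjacency b xs zs) ≡ true
  others []       []         _    = refl
  others (z ∷ zs) (y≢z ∷ y≢) sub′ with map (b y) xs ⊑ map (b z) xs in p | map (b z) xs ⊑ map (b y) xs in q
  ... | true  | _     = ⊥-elim (anti (sub (here refl)) (sub′ (here refl)) y≢z (⊑-map _ _ xs p))
  ... | false | true  = ⊥-elim (anti (sub′ (here refl)) (sub (here refl)) (y≢z ∘ sym) (⊑-map _ _ xs q))
  ... | false | false = others zs y≢ (sub′ ∘ there)

size-++ : ∀ r s → size (r ++ s) ≡ size r + size s
size-++ []          s = refl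
size-++ (true ∷ r)  s = cong suc (size-++ r s)
size-++ (false ∷ r) s = size-++ r s

size-↭ : ∀ {r s} → r ↭ s → size r ≡ size s
size-↭ _↭_.refl                 = refl
size-↭ (prep true p)        = cong suc (size-↭ p)
size-↭ (prep false p)       = size-↭ p
size-↭ (swap true true p)   = cong (2 +_) (size-↭ p)
size-↭ (swap true false p)  = cong suc (size-↭ p)
size-↭ (swap false true p)  = cong suc (size-↭ p)
size-↭ (swap false false p) = size-↭ p
size-↭ (_↭_.trans p q)          = trans (size-↭ p) (size-↭ q)

size≡0 : ∀ {f : V → Bool} {xs z} → z ∈ xs → size (map f xs) ≡ 0 → f z ≢ true
size≡0 {f = f} {x ∷ xs} z∈ eq fz with f x in fx
size≡0 (here refl) eq fz | false = contradiction (trans (sym fz) fx) λ ()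
size≡0 (there z∈)  eq fz | false = size≡0 z∈ eq fz

size-flip : IsTournament b → ∀ x {ys} → All (x ≢_) ys → size (map (b x) ys) + size (map (λ y → b y x) ys) ≡ length ys
size-flip isT x []         = refl
size-flip {b = b} isT x {y ∷ ys} (x≢y ∷ x≢) with b x y | b y x | flips isT x≢y
... | true  | false | _ = cong suc (size-flip isT x x≢)
... | false | true  | _ = trans (+-suc _ _) (cong suc (size-flip isT x x≢))

-- Outdegrees and walks

degree : (V → V → Bool) → List V → V → ℕ
degree b xs x = size (map (b x) xs)

degree-↭ : ∀ {xs ys} → xs ↭ ys → ∀ (x : V) → degree b xs x ≡ degree b ys x
degree-↭ p x = size-↭ (map⁺ _ p)

-- The number n(n - 1)/2 of arcs of a tournament on n vertices.
triangle : ℕ → ℕ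
triangle zero    = 0
triangle (suc n) = n + triangle n

-- Each arc counts once, at its tail. Adding `x` contributes its outdegree and one for each vertex
-- beating it, together one per other vertex.
sum-degrees : IsTournament b → ∀ {xs} → Unique xs → sum (map (degree b xs) xs) ≡ triangle (length xs)
sum-degrees isT [] = refl
sum-degrees {b = b} isT {x ∷ xs} (x≢ ∷ u) rewrite loopless isT x = begin
  size (map (b x) xs) + sum (map (degree b (x ∷ xs)) xs)
    ≡⟨ cong (size (map (b x) xs) +_) (split xs) ⟩
  size (map (b x) xs) + (size (map (λ y → b y x) xs) + sum (map (degree b xs) xs))
    ≡⟨ +-assoc (size (map (b x) xs)) _ _ ⟨
  size (map (b x) xs) + size (map (λ y → b y x) xs) + sum (map (degree b xs) xs)
    ≡⟨ cong₂ _+_ (size-flip isT x x≢) (sum-degrees isT u) ⟩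
  length xs + triangle (length xs) ∎
  where
  open ≡-Reasoning
  split : ∀ ys → sum (map (degree b (x ∷ xs)) ys) ≡ size (map (λ y → b y x) ys) + sum (map (degree b xs) ys)
  split []       = refl
  split (y ∷ ys) with b y x
  ... | true  = cong suc (trans (cong (size (map (b y) xs) +_) (split ys)) (x∙yz≈y∙xz +-commutativeSemigroup (degree b xs y) (size (map (λ z → b z x) ys)) _))
  ... | false = trans (cong (size (map (b y) xs) +_) (split ys)) (x∙yz≈y∙xz +-commutativeSemigroup (degree b xs y) (size (map (λ z → b z x) ys)) _)

*-≤-sum : ∀ {f : V → ℕ} {k xs} → All (λ x → k ≤ f x) xs → k * length xs ≤ sum (map f xs)
*-≤-sum {k = k} []                 = ≤-reflexive (*-zeroʳ k)
*-≤-sum {k = k} {x ∷ xs} (p ∷ ps) = ≤-trans (≤-reflexive (*-suc k (length xs))) (+-mono-≤ p (*-≤-sum ps))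

dot : List Bool → List ℕ → ℕ
dot (true ∷ r)  (w ∷ ws) = w + dot r ws
dot (false ∷ r) (w ∷ ws) = dot r ws
dot _           _        = 0

-- The number of walks with `ℓ` arcs starting at `x`.
walks : (V → V → Bool) → List V → ℕ → V → ℕ
walks b xs zero    x = 1
walks b xs (suc ℓ) x = dot (map (b x) xs) (map (walks b xs ℓ) xs)

walkCounts : ℕ → List (List Bool) → List ℕ
walkCounts zero    Rs = map (λ _ → 1) Rs
walkCounts (suc ℓ) Rs = advance (walkCounts ℓ Rs)
  where
  advance : List ℕ → List ℕ
  advance ws = map (λ R → dot R ws) Rs

walkCounts-adjacency : ∀ (b : V → V → Bool) xs ℓ → walkCounts ℓ (adjacency b xs xs) ≡ map (walks b xs ℓ) xs
walkCounts-adjacency b xs zero    = sym (map-∘ xs)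
walkCounts-adjacency b xs (suc ℓ) = trans
  (cong (λ ws → map (λ R → dot R ws) (adjacency b xs xs)) (walkCounts-adjacency b xs ℓ))
  (sym (map-∘ xs))

dot-↭ : ∀ (f : V → Bool) (w : V → ℕ) {xs ys} → xs ↭ ys → dot (map f xs) (map w xs) ≡ dot (map f ys) (map w ys)
dot-↭ f w _↭_.refl        = refl
dot-↭ f w (prep x p) with f x
... | true  = cong (w x +_) (dot-↭ f w p)
... | false = dot-↭ f w p
dot-↭ f w (swap x y p) with f x | f y
... | false | false = dot-↭ f w p
... | true  | false = cong (w x +_) (dot-↭ f w p)
... | false | true  = cong (w y +_) (dot-↭ f w p)
... | true  | true  = trans (cong (λ s → w x + (w y + s)) (dot-↭ f w p)) (x∙yz≈y∙xz +-commutativeSemigroup (w x) (w y) _)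
dot-↭ f w (_↭_.trans p q) = trans (dot-↭ f w p) (dot-↭ f w q)

walks-↭ : ∀ {xs ys} → xs ↭ ys → ∀ ℓ (x : V) → walks b xs ℓ x ≡ walks b ys ℓ x
walks-↭ p zero    x = refl
walks-↭ {b = b} {xs} {ys} p (suc ℓ) x = trans
  (cong (dot (map (b x) xs)) (map-cong-local (All.tabulate λ {y} _ → walks-↭ p ℓ y)))
  (dot-↭ (b x) (walks b ys ℓ) p)

leastAmong : ℕ → ℕ → List (List Bool) → List ℕ → Bool
leastAmong k w (R ∷ Rs) (w′ ∷ ws) = (if size R ≡ᵇ k then w ≤ᵇ w′ else true) ∧ leastAmong k w Rs ws
leastAmong k w _        _         = true

rooted? : ℕ → List (List Bool) → List ℕ → Bool
rooted? k Rs []       = true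
rooted? k Rs (w ∷ ws) = leastAmong k w Rs (w ∷ ws)

-- Among the vertices of minimal outdegree the root has the fewest walks of length 3; this only
-- reduces the number of roots under which a tournament is listed.
goodRows : ℕ → List (List Bool) → Bool
goodRows k Rs = antichain? Rs ∧ rooted? k Rs (walkCounts 3 Rs)

good : Code → Bool
good []      = true
good (r ∷ c) = goodRows (size r) (rows (r ∷ c))

Least : (V → V → Bool) → List V → V → Set
Least b xs u = ∀ {x} → x ∈ xs → degree b xs u ≤ degree b xs x ×
  (degree b xs x ≡ degree b xs u → walks b xs 3 u ≤ walks b xs 3 x)

least-↭ : ∀ {xs ys u} → xs ↭ ys → Least b xs u → Least b ys u
least-↭ {b = b} {u = u} p least {x} x∈ with least (∈-resp-↭ (↭-sym p) x∈)
... | d , w rewrite degree-↭ {b = b} p u | degree-↭ {b = b} p x | walks-↭ {b = b} p 3 u | walks-↭ {b = b} p 3 x = d , w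

argmin : ∀ (f : V → ℕ) x xs → ∃ λ u → u ∈ x ∷ xs × All (λ y → f u ≤ f y) (x ∷ xs)
argmin f x []       = x , here refl , ≤-refl ∷ []
argmin f x (y ∷ ys) with argmin f y ys
... | u , u∈ , u≤ with ≤-total (f x) (f u)
...   | inj₁ x≤u = x , here refl , ≤-refl ∷ All.map (≤-trans x≤u) u≤
...   | inj₂ u≤x = u , there u∈ , u≤x ∷ u≤

-- A lexicographic minimum in two stages: `v` minimises the degree, then the walk count is minimised
-- among the vertices tied with `v`.
least-exists : ∀ (b : V → V → Bool) x xs → ∃ λ u → u ∈ x ∷ xs × Least b (x ∷ xs) u
least-exists {V} b x xs with argmin (degree b (x ∷ xs)) x xs
... | v , v∈ , v≤ = pick (filterᵇ tie (x ∷ xs)) refl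
  where
  d : V → ℕ
  d = degree b (x ∷ xs)
  tie : V → Bool
  tie y = d y ≡ᵇ d v
  tie⁻ : ∀ {y} → y ∈ filterᵇ tie (x ∷ xs) → y ∈ x ∷ xs × d y ≡ d v
  tie⁻ y∈ with ∈-filterᵇ⁻ tie (x ∷ xs) y∈
  ... | y∈′ , e = y∈′ , ≡ᵇ⇒≡ _ _ (subst T (sym e) _)
  tie⁺ : ∀ {y} → y ∈ x ∷ xs → d y ≡ d v → y ∈ filterᵇ tie (x ∷ xs)
  tie⁺ {y} y∈ e = ∈-filterᵇ⁺ tie y∈ (≡true (≡⇒≡ᵇ (d y) (d v) e))
  pick : ∀ ts → ts ≡ filterᵇ tie (x ∷ xs) → ∃ λ u → u ∈ x ∷ xs × Least b (x ∷ xs) u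
  pick []       eq = contradiction (subst (v ∈_) (sym eq) (tie⁺ v∈ refl)) λ ()
  pick (t ∷ ts) eq with argmin (walks b (x ∷ xs) 3) t ts
  ... | u , u∈ , u≤ with tie⁻ (subst (u ∈_) eq u∈)
  ...   | u∈′ , du = u , u∈′ , λ {y} y∈ →
            ≤-trans (≤-reflexive du) (All.lookup v≤ y∈) ,
            λ e → All.lookup u≤ (subst (y ∈_) (sym eq) (tie⁺ y∈ (trans e du)))

-- Ensures that filtering by `good` never discards a code whose first vertex is a least root.
good-code : IsTournament b → ∀ {u xs} → Unique (u ∷ xs) → Antichain b (u ∷ xs) → Least b (u ∷ xs) u →
            good (code b (u ∷ xs)) ≡ true
good-code {b = b} isT {u} {xs} uniq anti least
  = trans (cong (goodRows k) (rows-code isT uniq)) (∧-true (antichain?-true anti uniq λ y∈ → y∈)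
      (trans (cong (rooted? k (adjacency b (u ∷ xs) (u ∷ xs))) (walkCounts-adjacency b (u ∷ xs) 3))
               (ties (u ∷ xs) λ y∈ → y∈)))
  where
  k : ℕ
  k = size (map (b u) xs)
  k≡ : degree b (u ∷ xs) u ≡ size (map (b u) xs)
  k≡ rewrite loopless isT u = refl
  ties : ∀ ys → (∀ {y} → y ∈ ys → y ∈ u ∷ xs) →
         leastAmong (size (map (b u) xs)) (walks b (u ∷ xs) 3 u) (adjacency b (u ∷ xs) ys) (map (walks b (u ∷ xs) 3) ys) ≡ true
  ties []       _   = refl
  ties (y ∷ ys) sub with degree b (u ∷ xs) y ≡ᵇ size (map (b u) xs) in eq
  ... | false = ties ys (sub ∘ there)
  ... | true  = ∧-true
    (≡true (≤⇒≤ᵇ (proj₂ (least (sub (here refl)))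
       (trans (≡ᵇ⇒≡ _ _ (subst T (sym eq) _)) (sym k≡)))))
    (ties ys (sub ∘ there))

-- Tournaments with a root of minimal outdegree

-- rel R R′ records which inclusion between the sets of out-neighbours in the other
-- part would complete a covering pair: below forbids the later one inside the earlier one.
data Rel : Set where
  free below above : Rel

-- Two vertices of a tournament never have equal rows, since one beats the other and not itself. At
-- most one inclusion therefore holds, and the order of the tests does not matter.
rel : List Bool → List Bool → Rel
rel R R′ = if R′ ⊑ R then below else (if R ⊑ R′ then above else free)

rels : List (List Bool) → List (List Rel)
rels []       = []
rels (R ∷ Rs) = map (rel R) Rs ∷ rels Rs

Domain : Set
Domain = List (List Bool)

discard : (List Bool → Bool) → Domain → Domain
discard p []      = []
discard p (S ∷ d) = if p S then discard p d else (S ∷ discard p d)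

∈-discard : ∀ p {S d} → S ∈ d → p S ≢ true → S ∈ discard p d
∈-discard p {S} {S′ ∷ d} S∈ ¬p with p S′ in eq
∈-discard p (here refl) ¬p | true  = contradiction eq ¬p
∈-discard p (there S∈)  ¬p | true  = ∈-discard p S∈ ¬p
∈-discard p (here refl) ¬p | false = here refl
∈-discard p (there S∈)  ¬p | false = there (∈-discard p S∈ ¬p)

keep : List Bool → Rel → Domain → Domain
keep S free  d = d
keep S below d = discard (_⊑ S) d
keep S above d = discard (S ⊑_) d

prune : List Bool → List Rel → List Domain → List Domain
prune S (r ∷ rs) (d ∷ ds) = keep S r d ∷ prune S rs ds
prune S _        _        = []

-- The numbers are budgets: how many further vertices of `M` may still beat a given vertex of `K`
-- before its outdegree drops below that of the root.
fits : List Bool → List ℕ → Bool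
fits (true ∷ S)  (zero ∷ g)  = false
fits (true ∷ S)  (suc _ ∷ g) = fits S g
fits (false ∷ S) (_ ∷ g)     = fits S g
fits _           _           = true

pay : List Bool → List ℕ → List ℕ
pay (true ∷ S)  (x ∷ g) = pred x ∷ pay S g
pay (false ∷ S) (x ∷ g) = x ∷ pay S g
pay _           _       = []

mutual
  fill : List (List Rel) → List Domain → List ℕ → List (List (List Bool))
  fill []       []       g = [] ∷ []
  fill (r ∷ rs) (d ∷ ds) g = fillFrom r rs d ds g
  fill _        _        g = []

  fillFrom : List Rel → List (List Rel) → Domain → List Domain → List ℕ → List (List (List Bool))
  fillFrom r rs []      ds g = []
  fillFrom r rs (S ∷ d) ds g =
    if fits S g then map (S ∷_) (fill rs (prune S r ds) (pay S g)) ++ fillFrom r rs d ds g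
                else fillFrom r rs d ds g

-- The counting functions follow the recursion of `fill` without building its results. On the last
-- row each affordable set gives exactly one completion.
countFits : Domain → List ℕ → ℕ
countFits []      g = 0
countFits (S ∷ d) g = if fits S g then suc (countFits d g) else countFits d g

mutual
  countFills : List (List Rel) → List Domain → List ℕ → ℕ
  countFills []            []       g = 1
  countFills (r ∷ [])      (d ∷ []) g = countFits d g
  countFills (r ∷ rs)      (d ∷ ds) g = countFillsFrom r rs d ds g
  countFills _             _        g = 0

  countFillsFrom : List Rel → List (List Rel) → Domain → List Domain → List ℕ → ℕ
  countFillsFrom r rs []      ds g = 0
  countFillsFrom r rs (S ∷ d) ds g =
    if fits S g then countFills rs (prune S r ds) (pay S g) + countFillsFrom r rs d ds g
                else countFillsFrom r rs d ds g

prune-[] : ∀ S r → prune S r [] ≡ []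
prune-[] S []      = refl
prune-[] S (_ ∷ _) = refl

length-fillLast : ∀ r d g → length (fillFrom r [] d [] g) ≡ countFits d g
length-fillLast r []      g = refl
length-fillLast r (S ∷ d) g with fits S g
... | false = length-fillLast r d g
... | true rewrite prune-[] S r = cong suc (length-fillLast r d g)

mutual
  length-fill : ∀ rs ds g → length (fill rs ds g) ≡ countFills rs ds g
  length-fill []            []            g = refl
  length-fill []            (_ ∷ _)       g = refl
  length-fill (r ∷ [])      []            g = refl
  length-fill (r ∷ _ ∷ _)   []            g = refl
  length-fill (r ∷ [])      (d ∷ [])      g = length-fillLast r d g
  length-fill (r ∷ [])      (d ∷ d′ ∷ ds) g = length-fillFrom r [] d (d′ ∷ ds) g
  length-fill (r ∷ r′ ∷ rs) (d ∷ ds)      g = length-fillFrom r (r′ ∷ rs) d ds g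

  length-fillFrom : ∀ r rs d ds g → length (fillFrom r rs d ds g) ≡ countFillsFrom r rs d ds g
  length-fillFrom r rs []      ds g = refl
  length-fillFrom r rs (S ∷ d) ds g with fits S g
  ... | false = length-fillFrom r rs d ds g
  ... | true  = trans (length-++ (map (S ∷_) (fill rs (prune S r ds) (pay S g))))
      (cong₂ _+_ (trans (length-map (S ∷_) (fill rs (prune S r ds) (pay S g))) (length-fill rs (prune S r ds) (pay S g)))
                 (length-fillFrom r rs d ds g))

module _ {W : Set} (σ : V → W → Bool) (ρ : V → List Bool) (ws : List W) where

  private
    S : V → List Bool
    S y = map (σ y) ws

  Compatible : V → V → Set
  Compatible y z = (ρ z ⊑ ρ y ≡ true → S z ⊑ S y ≢ true) × (ρ y ⊑ ρ z ≡ true → S y ⊑ S z ≢ true)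

  prune-complete : ∀ {y zs ds} → All (Compatible y) zs → Pointwise (λ z d → S z ∈ d) zs ds →
                   Pointwise (λ z d → S z ∈ d) zs (prune (S y) (map (rel (ρ y)) (map ρ zs)) ds)
  prune-complete []             []        = []
  prune-complete {y} {z ∷ zs} ((p , q) ∷ cs) (z∈ ∷ ps) with ρ z ⊑ ρ y in eq | ρ y ⊑ ρ z in eq′
  ... | true  | _     = ∈-discard (_⊑ S y) z∈ (p refl) ∷ prune-complete cs ps
  ... | false | true  = ∈-discard (S y ⊑_) z∈ (q refl) ∷ prune-complete cs ps
  ... | false | false = z∈ ∷ prune-complete cs ps

  load : List V → W → ℕ
  load ys w = size (map (λ y → σ y w) ys)

  afford : V → (W → ℕ) → W → ℕ
  afford y g w = if σ y w then pred (g w) else g w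

  fits-true : ∀ {y ys g} vs → All (λ w → load (y ∷ ys) w ≤ g w) vs → fits (map (σ y) vs) (map g vs) ≡ true
  fits-true []       []       = refl
  fits-true {y} {g = g} (v ∷ vs) (p ∷ ps) with σ y v | g v | p
  ... | false | _     | _     = fits-true vs ps
  ... | true  | suc _ | _     = fits-true vs ps

  pay-map : ∀ y g vs → pay (map (σ y) vs) (map g vs) ≡ map (afford y g) vs
  pay-map y g []       = refl
  pay-map y g (v ∷ vs) with σ y v
  ... | true  = cong (_ ∷_) (pay-map y g vs)
  ... | false = cong (_ ∷_) (pay-map y g vs)

  afford-enough : ∀ {y ys g} w → load (y ∷ ys) w ≤ g w → load ys w ≤ afford y g w
  afford-enough {y} {g = g} w p with σ y w
  ... | false = p
  ... | true  = pred-mono-≤ p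

  mutual
    -- The invariant is that each budget covers the arcs still to be placed into `w`. Paying for a
    -- row lowers load and budget together, and pruning drops only sets incompatible with that row.
    fill-complete : ∀ ys {ds g} → Pointwise (λ y d → S y ∈ d) ys ds → AllPairs Compatible ys →
                    All (λ w → load ys w ≤ g w) ws → map S ys ∈ fill (rels (map ρ ys)) ds (map g ws)
    fill-complete []       []        []       _  = here refl
    fill-complete (y ∷ ys) {d ∷ ds} {g} (y∈ ∷ ps) (c ∷ cs) ls = fillFrom-complete y∈
      where
      tail∈ : map S ys ∈ fill (rels (map ρ ys)) (prune (S y) (map (rel (ρ y)) (map ρ ys)) ds) (pay (S y) (map g ws))
      tail∈ = subst (λ g′ → map S ys ∈ fill (rels (map ρ ys)) (prune (S y) (map (rel (ρ y)) (map ρ ys)) ds) g′)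
        (sym (pay-map y g ws))
        (fill-complete ys (prune-complete c ps) cs (All.map (λ {w} → afford-enough {y} {ys} {g} w) ls))
      fillFrom-complete : ∀ {d} → S y ∈ d →
        map S (y ∷ ys) ∈ fillFrom (map (rel (ρ y)) (map ρ ys)) (rels (map ρ ys)) d ds (map g ws)
      fillFrom-complete (here refl) rewrite fits-true {y} {ys} {g} ws ls = ∈-++⁺ˡ (∈-map⁺ (S y ∷_) tail∈)
      fillFrom-complete {S′ ∷ d} (there y∈) with fits S′ (map g ws)
      ... | false = fillFrom-complete y∈
      ... | true  = ∈-++⁺ʳ (map (S′ ∷_) (fill (rels (map ρ ys))
          (prune S′ (map (rel (ρ y)) (map ρ ys)) ds) (pay S′ (map g ws)))) (fillFrom-complete y∈)

-- The vertices of M come first; Ss lists the rows from M into K.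
glue : Code → List (List Bool) → Code → Code
glue (R ∷ M) (S ∷ Ss) K = (R ++ S) ∷ glue M Ss K
glue _       _        K = K

glue-code : ∀ (b : V → V → Bool) ys ws →
            code b (ys ++ ws) ≡ glue (code b ys) (map (λ y → map (b y) ws) ys) (code b ws)
glue-code b []       ws = refl
glue-code b (y ∷ ys) ws = cong₂ _∷_ (map-++ (b y) ys ws) (glue-code b ys ws)

cone : ℕ → ℕ → Code → Code → List (List Bool) → Code
cone k m K M Ss = (replicate m false ++ replicate k true) ∷ glue M Ss K

-- A vertex of `M` beats the root, so it would cover the root if it beat all of `K`. The `suc`
-- counts its arc to the root in the outdegree, which is at least `k`.
domain : ℕ → List Bool → Domain
domain k R = filterᵇ (λ S → not (and S) ∧ (k ≤ᵇ suc (size R + size S))) (boolLists k)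

-- A vertex of `K` with row `R` that is beaten by `ℓ` of the `m` vertices of `M` has outdegree
-- `size R + m - ℓ`, as it loses to the root. This must be at least `k`.
budget : ℕ → ℕ → List Bool → ℕ
budget k m R = (m + size R) ∸ k

cones : ℕ → ℕ → Code → Code → List Code
cones k m K M = from (rows M)
  where
  from : List (List Bool) → List Code
  from Rs = map (cone k m K M) (fill (rels Rs) (map (domain k) Rs) (map (budget k m) (rows K)))

countCones : ℕ → ℕ → Code → Code → ℕ
countCones k m K M = from (rows M)
  where
  from : List (List Bool) → ℕ
  from Rs = countFills (rels Rs) (map (domain k) Rs) (map (budget k m) (rows K))

length-cones : ∀ k m K M → length (cones k m K M) ≡ countCones k m K M
length-cones k m K M = trans (length-map (cone k m K M) (fill (rels (rows M)) _ _)) (length-fill (rels (rows M)) _ _)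

and-map : ∀ {f : V → Bool} xs → and (map f xs) ≡ true → ∀ {z} → z ∈ xs → f z ≡ true
and-map {f = f} (x ∷ xs) p z∈ with f x in fx
and-map (x ∷ xs) p (here refl) | true = fx
and-map (x ∷ xs) p (there z∈)  | true = and-map xs p z∈

map-const : ∀ {f : V → Bool} {t xs} → All (λ x → f x ≡ t) xs → map f xs ≡ replicate (length xs) t
map-const []       = refl
map-const (p ∷ ps) = cong₂ _∷_ p (map-const ps)

unique-++ˡ : ∀ (xs : List V) {ys} → Unique (xs ++ ys) → Unique xs
unique-++ˡ []       _        = []
unique-++ˡ (x ∷ xs) (x≢ ∷ u) = All.tabulate (λ z∈ → All.lookup x≢ (∈-++⁺ˡ z∈)) ∷ unique-++ˡ xs u

unique-++ʳ : ∀ (xs : List V) {ys} → Unique (xs ++ ys) → Unique ys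
unique-++ʳ []       u       = u
unique-++ʳ (x ∷ xs) (_ ∷ u) = unique-++ʳ xs u

module _ {b : V → V → Bool} (isT : IsTournament b) {u : V} {ys ws : List V}
         (uniq : Unique (u ∷ ys ++ ws)) (ins : All (λ y → b u y ≡ false) ys) (outs : All (λ w → b u w ≡ true) ws)
         (anti : Antichain b (u ∷ ys ++ ws))
         (minimal : ∀ {x} → x ∈ u ∷ ys ++ ws → length ws ≤ degree b (u ∷ ys ++ ws) x) where

  private
    k m : ℕ
    k = length ws
    m = length ys

    u≢ : All (u ≢_) (ys ++ ws)
    u≢ = AllPairs.head uniq

    uniq′ : Unique (ys ++ ws)
    uniq′ = AllPairs.tail uniq

    R S : V → List Bool
    R y = map (b y) ys
    S y = map (b y) ws

    y∈⁺ : ∀ {y} → y ∈ ys → y ∈ u ∷ ys ++ ws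
    y∈⁺ y∈ = there (∈-++⁺ˡ y∈)

    w∈⁺ : ∀ {w} → w ∈ ws → w ∈ u ∷ ys ++ ws
    w∈⁺ w∈ = there (∈-++⁺ʳ ys w∈)

    back : ∀ {y} → y ∈ ys → b y u ≡ true
    back y∈ = trans (flips isT (All.lookup u≢ (∈-++⁺ˡ y∈) ∘ sym)) (cong not (All.lookup ins y∈))

    forth : ∀ {w} → w ∈ ws → b w u ≡ false
    forth w∈ = reverse isT (All.lookup outs w∈)

    S-proper : ∀ {y} → y ∈ ys → and (S y) ≢ true
    S-proper {y} y∈ full = anti (here refl) (y∈⁺ y∈) (All.lookup u≢ (∈-++⁺ˡ y∈)) dom
      where
      dom : ∀ {z} → z ∈ u ∷ ys ++ ws → b u z ≡ true → b y z ≡ true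
      dom (here refl) u≻u = contradiction (trans (sym u≻u) (loopless isT u)) λ ()
      dom (there z∈)  u≻z with ∈-++⁻ ys z∈
      ... | inj₁ z∈ys = contradiction (trans (sym u≻z) (All.lookup ins z∈ys)) λ ()
      ... | inj₂ z∈ws = and-map ws full z∈ws

    S∈domain : ∀ {y} → y ∈ ys → S y ∈ domain k (R y)
    S∈domain {y} y∈ = ∈-filterᵇ⁺ _
      (subst (λ n → S y ∈ boolLists n) (length-map (b y) ws) (∈-boolLists (S y)))
      (∧-true (¬true⇒not (S-proper y∈)) (≡true (≤⇒≤ᵇ (≤-trans (minimal (y∈⁺ y∈)) (≤-reflexive deg)))))
      where
      deg : degree b (u ∷ ys ++ ws) y ≡ suc (size (R y) + size (S y))
      deg rewrite back y∈ = cong suc (trans (cong size (map-++ (b y) ys ws)) (size-++ (R y) (S y)))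

    incomparable : ∀ {y z} → y ∈ ys → z ∈ ys → y ≢ z → R y ⊑ R z ≡ true → S y ⊑ S z ≢ true
    incomparable {y} {z} y∈ z∈ y≢z p q = anti (y∈⁺ y∈) (y∈⁺ z∈) y≢z dom
      where
      dom : ∀ {x} → x ∈ u ∷ ys ++ ws → b y x ≡ true → b z x ≡ true
      dom (here refl) _ = back z∈
      dom (there x∈)  y≻x with ∈-++⁻ ys x∈
      ... | inj₁ x∈ys = ⊑-map (b y) (b z) ys p x∈ys y≻x
      ... | inj₂ x∈ws = ⊑-map (b y) (b z) ws q x∈ws y≻x

    compatible : ∀ zs → Unique zs → (∀ {z} → z ∈ zs → z ∈ ys) → AllPairs (Compatible b R ws) zs
    compatible []       []       sub = []
    compatible (z ∷ zs) (z≢ ∷ un) sub =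
      All.tabulate (λ z′∈ →
        incomparable (sub (there z′∈)) (sub (here refl)) (All.lookup z≢ z′∈ ∘ sym) ,
        incomparable (sub (here refl)) (sub (there z′∈)) (All.lookup z≢ z′∈))
      ∷ compatible zs un (sub ∘ there)

    affordable : ∀ {w} → w ∈ ws → load b R ws ys w ≤ budget k m (map (b w) ws)
    affordable {w} w∈ = m+n≤o⇒m≤o∸n (load b R ws ys w) (begin
      ℓ + k                                        ≤⟨ +-monoʳ-≤ ℓ (minimal (w∈⁺ w∈)) ⟩
      ℓ + degree b (u ∷ ys ++ ws) w                ≡⟨ cong (ℓ +_) deg ⟩
      ℓ + (size (map (b w) ys) + size (S w))       ≡⟨ +-assoc ℓ _ _ ⟨
      ℓ + size (map (b w) ys) + size (S w)         ≡⟨ cong (_+ size (S w)) (trans (+-comm ℓ _) (size-flip isT w w≢)) ⟩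
      m + size (S w)                               ∎)
      where
      open ≤-Reasoning
      ℓ : ℕ
      ℓ = load b R ws ys w
      w≢ : All (w ≢_) ys
      w≢ = All.tabulate λ { y∈ refl → contradiction (trans (sym (All.lookup outs w∈)) (All.lookup ins y∈)) λ () }
      deg : degree b (u ∷ ys ++ ws) w ≡ size (map (b w) ys) + size (S w)
      deg rewrite forth w∈ = trans (cong size (map-++ (b w) ys ws)) (size-++ (map (b w) ys) (S w))

    domains : ∀ zs → (∀ {z} → z ∈ zs → z ∈ ys) → Pointwise (λ y d → S y ∈ d) zs (map (domain k) (map R zs))
    domains []       sub = []
    domains (z ∷ zs) sub = S∈domain (sub (here refl)) ∷ domains zs (sub ∘ there)

  code∈cones : code b (u ∷ ys ++ ws) ∈ cones k m (code b ws) (code b ys)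
  code∈cones
    rewrite rows-code isT (unique-++ˡ ys uniq′) | rows-code isT (unique-++ʳ ys uniq′) =
    subst₂ _∈_ (sym cone≡)
      (cong (λ g → map (cone k m (code b ws) (code b ys)) (fill (rels (map R ys)) (map (domain k) (map R ys)) g)) (map-∘ ws))
      (∈-map⁺ (cone k m (code b ws) (code b ys))
        (fill-complete b R ws ys {g = λ w → budget k m (map (b w) ws)}
          (domains ys λ y∈ → y∈) (compatible ys (unique-++ˡ ys uniq′) λ y∈ → y∈)
          (All.tabulate affordable)))
    where
    cone≡ : code b (u ∷ ys ++ ws) ≡ cone k m (code b ws) (code b ys) (map S ys)
    cone≡ = cong₂ _∷_ (trans (map-++ (b u) ys ws) (cong₂ _++_ (map-const ins) (map-const outs))) (glue-code b ys ws)

-- Roots of outdegree 1, …, t; by averaging t ≥ (n - 2) / 2 suffices, and outdegree 0 would be covered.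
branches : ℕ → ℕ → (ℕ → List Code) → (ℕ → List Code) → List Code
branches n t Ks Ms = concatMap (λ k → concatMap (λ K → concatMap (cones k (n ∸ suc k) K) (Ms (n ∸ suc k))) (Ks k)) (applyUpTo suc t)

countBranches : ℕ → ℕ → (ℕ → List Code) → (ℕ → List Code) → ℕ
countBranches n t Ks Ms = sum (map (λ k → sum (map (λ K → sum (map (countCones k (n ∸ suc k) K) (Ms (n ∸ suc k)))) (Ks k))) (applyUpTo suc t))

length-concatMap : ∀ {A B : Set} {f : A → List B} {g : A → ℕ} → (∀ x → length (f x) ≡ g x) →
                   ∀ xs → length (concatMap f xs) ≡ sum (map g xs)
length-concatMap eq []                = refl
length-concatMap {f = f} eq (x ∷ xs) = trans (length-++ (f x)) (cong₂ _+_ (eq x) (length-concatMap eq xs))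

length-branches : ∀ n t Ks Ms → length (branches n t Ks Ms) ≡ countBranches n t Ks Ms
length-branches n t Ks Ms = length-concatMap (λ k → length-concatMap (λ K → length-concatMap
  (length-cones k (n ∸ suc k) K) (Ms (n ∸ suc k))) (Ks k)) (applyUpTo suc t)

AntichainComplete : ℕ → List Code → Set₁
AntichainComplete n L = ∀ {V : Set} (b : V → V → Bool) → IsTournament b →
  ∀ xs → Unique xs → length xs ≡ n → Antichain b xs → ∃ λ ys → ys ↭ xs × code b ys ∈ L

split-↭ : ∀ (p : V → Bool) xs → xs ↭ filterᵇ (not ∘ p) xs ++ filterᵇ p xs
split-↭ p []       = ↭-refl
split-↭ p (x ∷ xs) with p x
... | false = prep x (split-↭ p xs)
... | true  = ↭-trans (prep x (split-↭ p xs)) (↭-sym (shift x (filterᵇ (not ∘ p) xs) (filterᵇ p xs)))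

-- The two neighbourhoods of a least root are reordered independently to meet listed codes.
-- Covering, degrees and walk counts survive reordering, so the root stays least and the filter
-- keeps the code.
branches-complete : ∀ {n t Ks Ms} → (∀ k → Complete k (Ks k)) → (∀ m → Complete m (Ms m)) →
  2 ≤ n → triangle n < suc t * n → AntichainComplete n (filterᵇ good (branches n t Ks Ms))
branches-complete {n} {t} {Ks} {Ms} K-complete M-complete 2≤n small {V} b isT (x ∷ xs) uniq refl anti
  with least-exists b x xs
... | u , u∈ , least with ∈-∃++ u∈
...   | as , bs , eq = result
  where
  xs′ ins outs : List V
  xs′  = as ++ bs
  ins  = filterᵇ (not ∘ b u) xs′
  outs = filterᵇ (b u) xs′

  p : x ∷ xs ↭ u ∷ xs′
  p = subst (_↭ u ∷ xs′) (sym eq) (shift u as bs)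

  q : x ∷ xs ↭ u ∷ ins ++ outs
  q = ↭-trans p (prep u (split-↭ (b u) xs′))

  uniq-split : Unique (ins ++ outs)
  uniq-split = AllPairs.tail (unique-↭ q uniq)

  ins-false : All (λ y → b u y ≡ false) ins
  ins-false = All.tabulate λ {y} y∈ → lemma (proj₂ (∈-filterᵇ⁻ (not ∘ b u) xs′ y∈))
    where
    lemma : ∀ {s} → not s ≡ true → s ≡ false
    lemma {false} _ = refl

  outs-true : All (λ w → b u w ≡ true) outs
  outs-true = All.tabulate λ y∈ → proj₂ (∈-filterᵇ⁻ (b u) xs′ y∈)

  result : ∃ λ zs → zs ↭ x ∷ xs × code b zs ∈ filterᵇ good (branches n t Ks Ms)
  result with M-complete (length ins) b isT ins (unique-++ˡ ins uniq-split) refl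
            | K-complete (length outs) b isT outs (unique-++ʳ ins uniq-split) refl
  ... | ys , ys↭ , ys∈ | ws , ws↭ , ws∈ = u ∷ ys ++ ws , ↭-sym r ,
    ∈-filterᵇ⁺ good
      (∈-concatMap⁺ _ (lose k∈ (∈-concatMap⁺ _ (lose ws∈′ (∈-concatMap⁺ _ (lose ys∈′ code∈))))))
      (good-code isT (unique-↭ r uniq) (antichain-↭ {b = b} r anti) (least-↭ {b = b} {u = u} r least))
    where
    r : x ∷ xs ↭ u ∷ ys ++ ws
    r = ↭-trans q (prep u (++⁺ (↭-sym ys↭) (↭-sym ws↭)))

    ins′ : All (λ y → b u y ≡ false) ys
    ins′ = All-resp-↭ (↭-sym ys↭) ins-false

    outs′ : All (λ w → b u w ≡ true) ws
    outs′ = All-resp-↭ (↭-sym ws↭) outs-true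

    k : ℕ
    k = length ws

    degree-u : degree b (u ∷ ys ++ ws) u ≡ k
    degree-u rewrite loopless isT u | map-++ (b u) ys ws | map-const ins′ | map-const outs′ =
      trans (size-++ (replicate (length ys) false) _) (cong₂ _+_ (size-false (length ys)) (size-true (length ws)))
      where
      size-false : ∀ n → size (replicate n false) ≡ 0
      size-false zero    = refl
      size-false (suc n) = size-false n
      size-true : ∀ n → size (replicate n true) ≡ n
      size-true zero    = refl
      size-true (suc n) = cong suc (size-true n)

    minimal : ∀ {z} → z ∈ u ∷ ys ++ ws → k ≤ degree b (u ∷ ys ++ ws) z
    minimal {z} z∈ = subst (_≤ degree b (u ∷ ys ++ ws) z) degree-u (proj₁ (least-↭ {b = b} {u = u} r least z∈))

    n≡ : n ≡ suc (length ys + k)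
    n≡ = trans (↭-length r) (cong suc (length-++ ys))

    m≡ : length ys ≡ n ∸ suc k
    m≡ = sym (trans (cong (_∸ suc k) n≡) (m+n∸n≡m (length ys) k))

    k≤t : k ≤ t
    k≤t with k ≤? t
    ... | yes p = p
    ... | no k≰t = contradiction small (≤⇒≯ (begin
      suc t * n                                       ≤⟨ *-monoˡ-≤ n (≰⇒> k≰t) ⟩
      k * n                                           ≡⟨ cong (k *_) (↭-length r) ⟩
      k * length (u ∷ ys ++ ws)                       ≤⟨ *-≤-sum (All.tabulate minimal) ⟩
      sum (map (degree b (u ∷ ys ++ ws)) (u ∷ ys ++ ws)) ≡⟨ sum-degrees isT (unique-↭ r uniq) ⟩
      triangle (length (u ∷ ys ++ ws))                ≡⟨ cong triangle (↭-length r) ⟨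
      triangle n                                      ∎))
      where open ≤-Reasoning

    k≢0 : k ≢ 0
    k≢0 k≡0 = case-ys ys refl
      where
      case-ys : ∀ ys′ → ys ≡ ys′ → ⊥
      -- Without in-neighbours either, the root would be the only vertex.
      case-ys []       refl = contradiction 2≤n (<⇒≱ (s≤s (≤-reflexive (trans n≡ (cong suc k≡0)))))
      case-ys (y ∷ _)  refl = antichain-↭ {b = b} r anti (here refl) (there (here refl))
        (λ { refl → contradiction (unique-↭ r uniq) λ { ((u≢u ∷ _) ∷ _) → u≢u refl } })
        λ z∈ u≻z → contradiction u≻z (size≡0 {f = b u} z∈ (trans degree-u k≡0))

    k∈ : k ∈ applyUpTo suc t
    k∈ with k | k≢0 | k≤t
    ... | zero  | ≢0 | _ = contradiction refl ≢0
    ... | suc i | _  | i<t = ∈-applyUpTo⁺ suc i<t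

    ws∈′ : code b ws ∈ Ks k
    ws∈′ = subst (λ i → code b ws ∈ Ks i) (sym (↭-length ws↭)) ws∈

    ys∈′ : code b ys ∈ Ms (n ∸ suc k)
    ys∈′ = subst (λ i → code b ys ∈ Ms i) (trans (sym (↭-length ys↭)) m≡) ys∈

    code∈ : code b (u ∷ ys ++ ws) ∈ cones k (n ∸ suc k) (code b ws) (code b ys)
    code∈ = subst (λ m → code b (u ∷ ys ++ ws) ∈ cones k m (code b ws) (code b ys)) m≡
      (code∈cones isT (unique-↭ r uniq) ins′ outs′ (antichain-↭ {b = b} r anti) minimal)

-- Isomorphisms and codes

beats-isTournament : (H : Tournament n) → IsTournament (beats H)
loopless (beats-isTournament H) = irrefl H
flips (beats-isTournament H) {x} {y} = tourn H x y

toT : ∀ n → Code → Tournament n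
beats  (toT n c) i j     = beatsAt c (toℕ i) (toℕ j)
irrefl (toT n c) i       = loopless (beatsAt-isTournament c) (toℕ i)
tourn  (toT n c) i j i≢j = flips (beatsAt-isTournament c) (i≢j ∘ toℕ-injective)

-- Distinct vertices are joined by an arc, and identifying them would turn it into a loop.
hom⇒injective : ∀ {V W : Set} {b : V → V → Bool} {b′ : W → W → Bool} → IsTournament b → IsTournament b′ →
                (φ : V → W) → (∀ x y → b x y ≡ b′ (φ x) (φ y)) → ∀ {x y} → φ x ≡ φ y → ¬ (x ≢ y)
hom⇒injective {b = b} {b′} isT isT′ φ hom {x} {y} φx≡φy x≢y =
  contradiction (trans (sym (no-arc φx≡φy)) (trans (flips isT x≢y) (cong not (no-arc (sym φx≡φy))))) λ ()
  where
  no-arc : ∀ {x y} → φ x ≡ φ y → b x y ≡ false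
  no-arc {x} {y} eq = trans (hom x y) (trans (cong (b′ (φ x)) (sym eq)) (loopless isT′ (φ x)))

∈⇒nth : ∀ {V : Set} (d : V) {xs x} → x ∈ xs → ∃ λ i → i < length xs × nth d xs i ≡ x
∈⇒nth d (here refl) = 0 , z<s , refl
∈⇒nth d (there x∈)  with ∈⇒nth d x∈
... | i , i< , eq = suc i , s<s i< , eq

length-allFin : ∀ n → length (allFin n) ≡ n
length-allFin n = length-tabulate {n = n} id

code⇒≅ : (H : Tournament (suc n)) → ∀ {ys c} → ys ↭ allFin (suc n) → code (beats H) ys ≡ c → H ≅ toT (suc n) c
code⇒≅ {n} H {ys} ys↭ refl =
  mk↔ₛ′ ψ φ (λ i → injective (φψ (φ i))) φψ ,
  λ x y → trans (cong₂ (beats H) (sym (φψ x)) (sym (φψ y))) (sym (hom (ψ x) (ψ y)))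
  where
  len : length ys ≡ suc n
  len = trans (↭-length ys↭) (length-allFin (suc n))
  φ : Fin (suc n) → Fin (suc n)
  φ i = nth zero ys (toℕ i)
  position : ∀ x → ∃ λ i → i < length ys × nth zero ys i ≡ x
  position x = ∈⇒nth zero (∈-resp-↭ (↭-sym ys↭) (∈-allFin x))
  ψ : Fin (suc n) → Fin (suc n)
  ψ x = fromℕ< (subst (proj₁ (position x) <_) len (proj₁ (proj₂ (position x))))
  φψ : ∀ x → φ (ψ x) ≡ x
  φψ x = trans (cong (nth zero ys) (toℕ-fromℕ< _)) (proj₂ (proj₂ (position x)))
  hom : ∀ i j → beats (toT (suc n) (code (beats H) ys)) i j ≡ beats H (φ i) (φ j)
  hom i j = beatsAt-code (beats-isTournament H) zero ys (unique-↭ (↭-sym ys↭) (allFin⁺ (suc n)))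
    (subst (toℕ i <_) (sym len) (toℕ<n i)) (subst (toℕ j <_) (sym len) (toℕ<n j))
  injective : ∀ {i j} → φ i ≡ φ j → i ≡ j
  injective {i} {j} eq with i ≟ᶠ j
  ... | yes i≡j = i≡j
  ... | no i≢j  = contradiction i≢j
    (hom⇒injective (beats-isTournament (toT (suc n) (code (beats H) ys))) (beats-isTournament H) φ hom eq)

≅-sym : {H H′ : Tournament n} → H ≅ H′ → H′ ≅ H
≅-sym {H′ = H′} (φ , hom) =
  mk↔ₛ′ from to strictlyInverseʳ strictlyInverseˡ ,
  λ i j → trans (cong₂ (beats H′) (sym (strictlyInverseˡ i)) (sym (strictlyInverseˡ j))) (sym (hom (from i) (from j)))
  where open Inverse φ

retentive-≅ : {H H′ : Tournament n} → H ≅ H′ → TauRetentiveTournament H → TauRetentiveTournament H′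
retentive-≅ {H = H} {H′} iso (m , T , R , minR , ε , inj , ε∈R , onto , hom) =
  m , T , R , minR , ε ∘ to , (λ i j eq → to-injective (inj _ _ eq)) , ε∈R ∘ to ,
  (λ x x∈ → let (i , eq) = onto x x∈ in from i , trans (cong ε (strictlyInverseˡ i)) eq) ,
  λ i j → trans (proj₂ (≅-sym {H = H} {H′} iso) i j) (hom (to i) (to j))
  where
  open Inverse (proj₁ (≅-sym {H = H} {H′} iso))
  to-injective : ∀ {i j} → to i ≡ to j → i ≡ j
  to-injective {i} {j} eq = trans (sym (strictlyInverseʳ i)) (trans (cong from eq) (strictlyInverseʳ j))

-- Counting representatives

retentive⇒listed : ∀ {L} → AntichainComplete n L → (H : Tournament n) → TauRetentiveTournament H →
                   ∃ λ ys → ys ↭ allFin n × code (beats H) ys ∈ L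
retentive⇒listed {n} complete H ret = complete (beats H) (beats-isTournament H) (allFin n) (allFin⁺ n) (length-allFin n)
  λ {x} {y} _ _ x≢y dom → retentive⇒uncovered {H = H} ret y x (x≢y ∘ sym) λ z → dom (∈-allFin z)

-- Invariant under isomorphism, so isomorphic codes always get compared in `represented`.
weight : Code → ℕ
weight c = sum (map (λ w → w * w * w) (walkCounts 3 (rows c)))

-- Removing repetitions is only worthwhile up to seven vertices.
allCodes : ℕ → List Code
allCodes zero    = [] ∷ []
allCodes (suc n) = (if n <ᵇ 7 then Dedupe.dedupe weight (suc n) else id) (extend n (allCodes n))

allCodes-complete : ∀ n → Complete n (allCodes n)
allCodes-complete zero b isT [] u refl = [] , _↭_.refl , here refl
allCodes-complete (suc n) with n <ᵇ 7
... | true  = Dedupe.dedupe-complete weight (suc n) (extend-complete (allCodes-complete n))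
... | false = extend-complete (allCodes-complete n)

antichain-dedupe : ∀ {L} → AntichainComplete n L → AntichainComplete n (Dedupe.dedupe weight n L)
antichain-dedupe {n} complete b isT xs u len anti with complete b isT xs u len anti
... | ys , ys↭ , c∈ with Dedupe.dedupe-sound weight n isT ys (unique-↭ (↭-sym ys↭) u) (trans (↭-length ys↭) len) c∈
...   | zs , zs↭ , d∈ = zs , ↭-trans zs↭ ys↭ , d∈

unfiltered : ∀ {L} → AntichainComplete n (filterᵇ good L) → AntichainComplete n L
unfiltered complete b isT xs u len anti with complete b isT xs u len anti
... | ys , ys↭ , c∈ = ys , ys↭ , proj₁ (∈-filterᵇ⁻ good _ c∈)

at-most : ∀ {L k} → AntichainComplete (suc n) L → length L ≤ k → βLe (suc n) k
-- Indices past the end of `L` get the default code `[]`; `βLe` asks nothing of surplus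
-- representatives.
at-most {n} {L} {k} complete short = (λ i → toT (suc n) (nth [] L (toℕ i))) , represent
  where
  represent : ∀ H → TauRetentiveTournament H → ∃ λ i → H ≅ toT (suc n) (nth [] L (toℕ i))
  represent H ret with retentive⇒listed complete H ret
  ... | ys , ys↭ , c∈ with ∈⇒nth [] c∈
  ...   | i , i<L , eq = fromℕ< i<k , code⇒≅ H ys↭ (trans (sym eq) (cong (nth [] L) (sym (toℕ-fromℕ< i<k))))
    where
    i<k : i < k
    i<k = <-≤-trans i<L short

standard : ∀ n → Code → Code
standard n c = code (beats (toT n c)) (allFin n)

pointwise-replicate⁺ : ∀ {A : Set} {d : List A} {ys} → All (_∈ d) ys → Pointwise _∈_ ys (replicate (length ys) d)
pointwise-replicate⁺ []       = []
pointwise-replicate⁺ (p ∷ ps) = p ∷ pointwise-replicate⁺ ps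

-- The isomorphism lists the vertices of `d` in an order whose code is that of `c`, so the search
-- cannot fail.
≅⇒rearrange : ∀ c d → toT n c ≅ toT n d → rearrange n d (standard n c) ≢ nothing
≅⇒rearrange {n} c d (φ , hom) eq = Search.embed-complete (beatsAt d) (beatsAt-isTournament d) is
    (Unique.map⁺ (injective ∘ toℕ-injective) (allFin⁺ n))
    (subst (λ k → Pointwise _∈_ is (replicate k (upTo n))) len (pointwise-replicate⁺ (All.tabulate bounded)))
    (subst (λ p → Search.embed (beatsAt d) p (replicate n (upTo n)) ≡ nothing)
           (sym (code-map {b′ = beatsAt d} {f = toℕ ∘ to} (allFin n) λ {x} {y} _ _ → sym (hom x y))) eq)
  where
  open Inverse φ
  injective : ∀ {i j} → to i ≡ to j → i ≡ j
  injective {i} {j} e = trans (sym (strictlyInverseʳ i)) (trans (cong from e) (strictlyInverseʳ j))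
  is : List ℕ
  is = map (toℕ ∘ to) (allFin n)
  len : length is ≡ n
  len = trans (length-map (toℕ ∘ to) (allFin n)) (length-allFin n)
  bounded : ∀ {i} → i ∈ is → i ∈ upTo n
  bounded i∈ with ∈-map⁻ (toℕ ∘ to) i∈
  ... | x , _ , refl = ∈-upTo⁺ (toℕ<n (to x))

distinct? : ℕ → List Code → Bool
distinct? n []      = true
distinct? n (c ∷ L) = all (λ d → is-nothing (rearrange n d (standard n c))) L ∧ distinct? n L

∧-trueˡ : ∀ {s t} → s ∧ t ≡ true → s ≡ true
∧-trueˡ {true} _ = refl

∧-trueʳ : ∀ {s t} → s ∧ t ≡ true → t ≡ true
∧-trueʳ {true} p = p

all-true : ∀ {A : Set} {p : A → Bool} xs → all p xs ≡ true → All (λ x → p x ≡ true) xs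
all-true []       _  = []
all-true (x ∷ xs) eq = ∧-trueˡ eq ∷ all-true xs (∧-trueʳ eq)

distinct : ∀ n L → distinct? n L ≡ true → ∀ {i j} → i < j → j < length L →
           ¬ (toT n (nth [] L i) ≅ toT n (nth [] L j))
distinct n (c ∷ L) eq {zero} {suc j} _ (s<s j<) iso =
  no-iso (All.lookup (all-true L (∧-trueˡ eq)) (nth-∈ [] L j<))
  where
  no-iso : is-nothing (rearrange n (nth [] L j) (standard n c)) ≢ true
  no-iso p with rearrange n (nth [] L j) (standard n c) in e
  ... | nothing = ≅⇒rearrange c (nth [] L j) iso e
distinct n (c ∷ L) eq {suc i} {suc j} (s<s i<j) (s<s j<) iso =
  distinct n L (∧-trueʳ {all _ L} eq) i<j j< iso

-- An undecided tournament is kept as a candidate but not accepted as retentive, so it would make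
-- `exact?` false instead of distorting the count.
plausible confirmed : {P : Set} → Maybe (Dec P) → Bool
plausible (just (no _)) = false
plausible _             = true
confirmed (just (yes _)) = true
confirmed _              = false

plausible-true : {P : Set} (d : Maybe (Dec P)) → P → plausible d ≡ true
plausible-true (just (yes _)) p = refl
plausible-true (just (no ¬p)) p = contradiction p ¬p
plausible-true nothing        p = refl

confirmed-sound : {P : Set} (d : Maybe (Dec P)) → confirmed d ≡ true → P
confirmed-sound (just (yes p)) _ = p

exact? : ℕ → ℕ → List Code → Bool
exact? n k L = (length L ≡ᵇ k) ∧ (all (λ c → confirmed (retentive? (toT (suc n) c))) L ∧ distinct? (suc n) L)

candidates : ℕ → List Code → List Code
candidates n = filterᵇ λ c → plausible (retentive? (toT (suc n) c))

exactly : ∀ {L k} → AntichainComplete (suc n) L → exact? n k (candidates n L) ≡ true → βEq (suc n) k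
exactly {n} {L} {k} complete ok =
  reps , (λ i → confirmed-sound (retentive? (reps i)) (All.lookup (all-true C oks) (nth-∈ [] C (bound i)))) ,
  apart , represent
  where
  C : List Code
  C = candidates n L
  len : length C ≡ k
  len = ≡ᵇ⇒≡ (length C) k (subst T (sym (∧-trueˡ ok)) tt)
  oks : all (λ c → confirmed (retentive? (toT (suc n) c))) C ≡ true
  oks = ∧-trueˡ (∧-trueʳ {length C ≡ᵇ k} ok)
  different : distinct? (suc n) C ≡ true
  different = ∧-trueʳ {all (λ c → confirmed (retentive? (toT (suc n) c))) C} (∧-trueʳ {length C ≡ᵇ k} ok)
  reps : Fin k → Tournament (suc n)
  reps i = toT (suc n) (nth [] C (toℕ i))
  bound : ∀ (i : Fin k) → toℕ i < length C
  bound i = subst (toℕ i <_) (sym len) (toℕ<n i)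
  apart : ∀ i j → i ≢ j → ¬ (reps i ≅ reps j)
  apart i j i≢j iso with <-cmp (toℕ i) (toℕ j)
  ... | tri< i<j _ _ = distinct (suc n) C different i<j (bound j) iso
  ... | tri≈ _ eq _  = i≢j (toℕ-injective eq)
  ... | tri> _ _ j<i = distinct (suc n) C different j<i (bound i) (≅-sym {H = reps i} {reps j} iso)
  represent : ∀ H → TauRetentiveTournament H → ∃ λ i → H ≅ reps i
  represent H ret with retentive⇒listed complete H ret
  ... | ys , ys↭ , c∈ with ∈⇒nth [] (∈-filterᵇ⁺ (λ c → plausible (retentive? (toT (suc n) c))) c∈
          (plausible-true (retentive? (toT (suc n) c)) (retentive-≅ {H = H} {toT (suc n) c} iso ret)))
    where
    c : Code
    c = code (beats H) ys
    iso : H ≅ toT (suc n) c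
    iso = code⇒≅ H ys↭ refl
  ...   | i , i<C , eq = fromℕ< i<k , code⇒≅ H ys↭ (trans (sym eq) (cong (nth [] C) (sym (toℕ-fromℕ< i<k))))
    where
    i<k : i < k
    i<k = subst (i <_) len i<C

-- Abstract, so that these lists are evaluated for the five computations only,
-- and never when types mentioning them are compared.
abstract
  listing sieved distinctCodes : ℕ → ℕ → List Code
  listing n t       = branches n t allCodes allCodes
  sieved n t        = filterᵇ good (listing n t)
  distinctCodes n t = Dedupe.dedupe weight n (sieved n t)

  size-listing : ℕ → ℕ → ℕ
  size-listing n t = countBranches n t allCodes allCodes

  length-listing : ∀ n t → length (listing n t) ≡ size-listing n t
  length-listing n t = length-branches n t allCodes allCodes

  sieved-complete : ∀ n t → 2 ≤ n → triangle n < suc t * n → AntichainComplete n (sieved n t)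
  sieved-complete n t = branches-complete {t = t} allCodes-complete allCodes-complete

  listing-complete : ∀ n t → 2 ≤ n → triangle n < suc t * n → AntichainComplete n (listing n t)
  listing-complete n t 2≤n small = unfiltered (sieved-complete n t 2≤n small)

  distinctCodes-complete : ∀ n t → 2 ≤ n → triangle n < suc t * n → AntichainComplete n (distinctCodes n t)
  distinctCodes-complete n t 2≤n small = antichain-dedupe (sieved-complete n t 2≤n small)

  six-vertices : exact? 5 2 (candidates 5 (distinctCodes 6 2)) ≡ true
  six-vertices = refl

  seven-vertices : exact? 6 26 (candidates 6 (distinctCodes 7 3)) ≡ true
  seven-vertices = refl

  eight-vertices : (length (distinctCodes 8 3) ≤ᵇ 395) ≡ true
  eight-vertices = refl

  nine-vertices : (length (sieved 9 4) ≤ᵇ 30596) ≡ true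
  nine-vertices = refl

  -- Only the constraints built into `domain`, `rel` and `budget` are imposed here; the remaining
  -- tests would require each code to be built.
  ten-vertices : (size-listing 10 4 ≤ᵇ 3881175) ≡ true
  ten-vertices = refl

≤ᵇ-true : ∀ {i j} → (i ≤ᵇ j) ≡ true → i ≤ j
≤ᵇ-true {i} {j} eq = ≤ᵇ⇒≤ i j (subst T (sym eq) tt)

theorem3 : βEq 6 2 × βEq 7 26 × βLe 8 395 × βLe 9 30596 × βLe 10 3881175
theorem3 =
  -- Here and below the second argument is the least t with n(n - 1)/2 < (t + 1)n: 2, 3, 3, 4 and 4
  -- for n from 6 to 10.
  exactly (distinctCodes-complete 6 2 (≤ᵇ-true refl) (≤ᵇ-true refl)) six-vertices ,
  exactly (distinctCodes-complete 7 3 (≤ᵇ-true refl) (≤ᵇ-true refl)) seven-vertices ,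
  at-most (distinctCodes-complete 8 3 (≤ᵇ-true refl) (≤ᵇ-true refl)) (≤ᵇ-true eight-vertices) ,
  at-most (sieved-complete 9 4 (≤ᵇ-true refl) (≤ᵇ-true refl)) (≤ᵇ-true nine-vertices) ,
  at-most (listing-complete 10 4 (≤ᵇ-true refl) (≤ᵇ-true refl))
    (≤-trans (≤-reflexive (length-listing 10 4)) (≤ᵇ-true ten-vertices))
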